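{- The classifying (syntactic) category $\mathcal{C}$ of objective type theory (defined in the context below) is a path category whose fibrations are exactly the fibrations of $\mathcal{C}$ as defined below: i.e. there is a class of weak equivalences in $\mathcal{C}$ such that $\mathcal{C}$, with these fibrations and weak equivalences, satisfies the axioms of a path category.
   Context: Objective type theory is the formal system with judgements $\vdash \Gamma\ \mathrm{Ctxt}$, $\Gamma \vdash \sigma \in \mathrm{Type}$, $\Gamma \vdash a \in \sigma$ (expressions up to $\alpha$-equivalence, written $\equiv$; no definitional equality and no conversion rule), with rules: empty context, context extension by a type with fresh variable, the variable rule; $\Pi$-types $\Pi(A,[x]B)$ with $\lambda(A,[x]B,[x]t) \in \Pi(A,[x]B)$, $\mathbf{app}(A,[x]B,f,a) \in B[a/x]$ and a propositional computation rule $\mathbf{betaconv}(A,[x]B,a,[x]t) \in \mathbf{app}(A,[x]B,\lambda(A,[x]B,[x]t),a) =_{B[a/x]} t[a/x]$; identity types $a =_A b$ with $\mathbf{refl}(A,a) \in a=_A a$, eliminator: from $\Gamma, x\in A, y \in A, u \in x =_A y \vdash P \in \mathrm{Type}$, $\Gamma \vdash p \in a =_A b$, $\Gamma, x \in A \vdash d \in P[x,x,\mathbf{refl}(A,x)/x,y,u]$ infer $\Gamma \vdash \mathbf{idrec}(A,[x,y,u]P,a,b,p,[x]d) \in P[a,b,p/x,y,u]$, and propositional computation rule: (with $\Gamma\vdash a\in A$) $\mathbf{idconv}(A,[x,y,u]P,a,[x]d) \in \mathbf{idrec}(A,[x,y,u]P,a,a,\mathbf{refl}(A,a),[x]d) =_{P[a,a,\mathbf{refl}(A,a)/x,y,u]}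 d[a/x]$. Classifying category: objects are contexts $\Gamma$ with $\vdash \Gamma\ \mathrm{Ctxt}$; a morphism $\Delta \to \Gamma$ where $\Gamma = [x_1\in\sigma_1,\ldots,x_n\in\sigma_n]$ is a sequence of terms $(t_1,\ldots,t_n)$ with $\Delta \vdash t_i \in \sigma_i[t_1,\ldots,t_{i-1}/x_1,\ldots,x_{i-1}]$ for all $i$, two such being equal iff componentwise syntactically equal; identity is $(x_1,\ldots,x_n)$ and composition is substitution: $(t_1,\ldots,t_n)\circ g = (t_1[g],\ldots,t_n[g])$. A display map is a morphism $[\Gamma, x\in\sigma] \to \Gamma$ of the form $(x_1,\ldots,x_{n})$ dropping the last variable, for $\Gamma \vdash \sigma \in \mathrm{Type}$; the fibrations are the closure of the display maps together with the isomorphisms under composition. A path category is a category with two classes of maps, fibrations and weak equivalences (trivial fibrations being maps in both), such that: fibrations are closed under composition and contain the isomorphisms; pullbacks of fibrations along arbitrary maps exist and are fibrations; there is a terminal object and every map to it is a fibration; isomorphisms are weak equivalences; weak equivalences satisfy 2-out-of-6; every object $X$ has a path object, i.e. a factorisation of the diagonal $X \to X\times X$ as a weak equivalence $X \to PX$ followed by a fibration $PX \to X\times X$; pullbacks of trivial fibrations along arbitrary maps are trivial fibrations; every trivial fibration has a section. -}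

module Defs where

open import Level using (Level; _⊔_; 0ℓ) renaming (suc to lsuc)
open import Data.Nat.Base using (ℕ; _+_) renaming (suc to 1+_)
open import Data.Fin.Base using (Fin; zero; suc)
open import Data.Fin.Substitution using (Sub; Subs; Lift; Application; TermSubst)
open import Data.Fin.Substitution.Lemmas using (TermLemmas)
open import Data.Product.Base using (Σ-syntax; _×_; _,_)
open import Data.Vec.Base using ([]; _∷_; lookup; map)
open import Data.Vec.Properties using (lookup-map)
open import Relation.Binary.Construct.Closure.ReflexiveTransitive using (ε; _◅_)
open import Relation.Binary.Core using (Rel)
open import Relation.Binary.PropositionalEquality using (_≡_; refl; sym; trans; cong; cong₂; subst; module ≡-Reasoning)
open import Relation.Binary.Structures using (IsEquivalence)

record Category (o ℓ e : Level) : Set (lsuc (o ⊔ ℓ ⊔ e)) where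
  infix  4 _⇒_ _≈_
  infixr 9 _∘_

  field
    Obj : Set o
    _⇒_ : Obj → Obj → Set ℓ
    _≈_ : ∀ {A B} → Rel (A ⇒ B) e
    id  : ∀ {A} → A ⇒ A
    _∘_ : ∀ {A B C} → B ⇒ C → A ⇒ B → A ⇒ C

    isEquivalence : ∀ {A B} → IsEquivalence (_≈_ {A} {B})
    ∘-resp-≈  : ∀ {A B C} {f f′ : B ⇒ C} {g g′ : A ⇒ B} → f ≈ f′ → g ≈ g′ → f ∘ g ≈ f′ ∘ g′
    assoc     : ∀ {A B C D} {f : A ⇒ B} {g : B ⇒ C} {h : C ⇒ D} → (h ∘ g) ∘ f ≈ h ∘ (g ∘ f)
    identityˡ : ∀ {A B} {f : A ⇒ B} → id ∘ f ≈ f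
    identityʳ : ∀ {A B} {f : A ⇒ B} → f ∘ id ≈ f

module _ {o ℓ e : Level} (C : Category o ℓ e) where
  open Category C

  record IsIso {A B : Obj} (f : A ⇒ B) : Set (ℓ ⊔ e) where
    field
      inv  : B ⇒ A
      isoˡ : inv ∘ f ≈ id
      isoʳ : f ∘ inv ≈ id

  record IsTerminal (⊤ : Obj) : Set (o ⊔ ℓ ⊔ e) where
    field
      !        : ∀ {A} → A ⇒ ⊤
      !-unique : ∀ {A} (f : A ⇒ ⊤) → f ≈ !

  record IsPullback {P X Y Z : Obj} (p₁ : P ⇒ X) (p₂ : P ⇒ Y) (f : X ⇒ Z) (g : Y ⇒ Z) :
                    Set (o ⊔ ℓ ⊔ e) where
    field
      commutes  : f ∘ p₁ ≈ g ∘ p₂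
      universal : ∀ {A} {h : A ⇒ X} {k : A ⇒ Y} → f ∘ h ≈ g ∘ k → A ⇒ P
      p₁∘universal : ∀ {A} {h : A ⇒ X} {k : A ⇒ Y} (eq : f ∘ h ≈ g ∘ k) → p₁ ∘ universal eq ≈ h
      p₂∘universal : ∀ {A} {h : A ⇒ X} {k : A ⇒ Y} (eq : f ∘ h ≈ g ∘ k) → p₂ ∘ universal eq ≈ k
      unique    : ∀ {A} {u v : A ⇒ P} → p₁ ∘ u ≈ p₁ ∘ v → p₂ ∘ u ≈ p₂ ∘ v → u ≈ v

  record Pullback {X Y Z : Obj} (f : X ⇒ Z) (g : Y ⇒ Z) : Set (o ⊔ ℓ ⊔ e) where
    field
      {P} : Obj
      p₁  : P ⇒ X
      p₂  : P ⇒ Y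
      isPullback : IsPullback p₁ p₂ f g

  record Product (X Y : Obj) : Set (o ⊔ ℓ ⊔ e) where
    field
      X×Y   : Obj
      π₁    : X×Y ⇒ X
      π₂    : X×Y ⇒ Y
      ⟨_,_⟩ : ∀ {A} → A ⇒ X → A ⇒ Y → A ⇒ X×Y
      π₁∘⟨⟩ : ∀ {A} {h : A ⇒ X} {k : A ⇒ Y} → π₁ ∘ ⟨ h , k ⟩ ≈ h
      π₂∘⟨⟩ : ∀ {A} {h : A ⇒ X} {k : A ⇒ Y} → π₂ ∘ ⟨ h , k ⟩ ≈ k
      unique : ∀ {A} {u v : A ⇒ X×Y} → π₁ ∘ u ≈ π₁ ∘ v → π₂ ∘ u ≈ π₂ ∘ v → u ≈ v

  record MapClass (p : Level) : Set (o ⊔ ℓ ⊔ e ⊔ lsuc p) where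
    field
      holds  : ∀ {A B} → A ⇒ B → Set p
      resp-≈ : ∀ {A B} {f g : A ⇒ B} → f ≈ g → holds f → holds g

  infix 4 _∈_
  _∈_ : ∀ {p A B} → A ⇒ B → MapClass p → Set p
  f ∈ K = MapClass.holds K f

  module _ {p q : Level} (Fib : MapClass p) (W : MapClass q) where

    record PathObject (X : Obj) (X×X : Product X X) : Set (o ⊔ ℓ ⊔ e ⊔ p ⊔ q) where
      open Product X×X using (⟨_,_⟩) renaming (X×Y to XX)
      field
        PX  : Obj
        r   : X ⇒ PX
        st  : PX ⇒ XX
        r∈W       : r ∈ W
        st∈Fib    : st ∈ Fib
        factorises : st ∘ r ≈ ⟨ id , id ⟩

    record IsPathCategory : Set (o ⊔ ℓ ⊔ e ⊔ p ⊔ q) where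
      field
        fib-∘   : ∀ {A B C} {f : B ⇒ C} {g : A ⇒ B} → f ∈ Fib → g ∈ Fib → f ∘ g ∈ Fib
        fib-iso : ∀ {A B} {f : A ⇒ B} → IsIso f → f ∈ Fib

        pullback     : ∀ {X Y Z} {f : X ⇒ Z} → f ∈ Fib → (g : Y ⇒ Z) → Pullback f g
        fib-pullback : ∀ {P X Y Z} {p₁ : P ⇒ X} {p₂ : P ⇒ Y} {f : X ⇒ Z} {g : Y ⇒ Z} →
                       IsPullback p₁ p₂ f g → f ∈ Fib → p₂ ∈ Fib

        ⊤            : Obj
        ⊤-isTerminal : IsTerminal ⊤
        fib-to-⊤     : ∀ {A} (f : A ⇒ ⊤) → f ∈ Fib

        w-iso    : ∀ {A B} {f : A ⇒ B} → IsIso f → f ∈ W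
        w-2-of-6 : ∀ {A B C D} {f : A ⇒ B} {g : B ⇒ C} {h : C ⇒ D} →
                    g ∘ f ∈ W → h ∘ g ∈ W →
                    f ∈ W × g ∈ W × h ∈ W × h ∘ g ∘ f ∈ W

        -- Products are determined up to isomorphism, and exist by ‘pullback’ along a
        -- map to ⊤, so quantifying over all of them fixes no choice and is not vacuous.
        pathObject : ∀ X (X×X : Product X X) → PathObject X X×X

        trivial-fib-pullback : ∀ {P X Y Z} {p₁ : P ⇒ X} {p₂ : P ⇒ Y} {f : X ⇒ Z} {g : Y ⇒ Z} →
                               IsPullback p₁ p₂ f g →
                               f ∈ Fib → f ∈ W → p₂ ∈ Fib × p₂ ∈ W
        trivial-fib-section  : ∀ {A B} {f : A ⇒ B} → f ∈ Fib → f ∈ W →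
                               Σ[ s ∈ B ⇒ A ] f ∘ s ≈ id

  data Closure {d} (D : ∀ {A B} → A ⇒ B → Set d) : ∀ {A B} → A ⇒ B → Set (o ⊔ ℓ ⊔ e ⊔ d) where
    base : ∀ {A B} {f : A ⇒ B} → D f → Closure D f
    iso  : ∀ {A B} {f : A ⇒ B} → IsIso f → Closure D f
    comp : ∀ {A B C} {f : B ⇒ C} {g : A ⇒ B} → Closure D f → Closure D g → Closure D (f ∘ g)
    resp : ∀ {A B} {f g : A ⇒ B} → f ≈ g → Closure D f → Closure D g

-- The rules for Π- and identity types alone derive no type at all (every type former
-- needs a type to start from), so the theory is taken over an arbitrary collection
-- of atomic types.  For Atom = ⊥ this is the pure theory of Π- and identity types.

module ObjectiveTypeTheory (Atom : Set) where

  private variable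
    k m n : ℕ

  -- De Bruijn expressions, so that α-equivalence is _≡_.  Types and terms share one
  -- grammar; the judgements tell them apart.  An abstraction [x,y,u]P is an expression
  -- with three more variables, where the last one bound (u) has index zero.

  data Exp (n : ℕ) : Set where
    var      : Fin n → Exp n
    atom     : Atom → Exp n
    Π        : (A : Exp n) (B : Exp (1+ n)) → Exp n
    lam      : (A : Exp n) (B t : Exp (1+ n)) → Exp n
    app      : (A : Exp n) (B : Exp (1+ n)) (f a : Exp n) → Exp n
    betaconv : (A : Exp n) (B : Exp (1+ n)) (a : Exp n) (t : Exp (1+ n)) → Exp n
    Id       : (A a b : Exp n) → Exp n
    rfl      : (A a : Exp n) → Exp n
    idrec    : (A : Exp n) (P : Exp (3 + n)) (a b p : Exp n) (d : Exp (1+ n)) → Exp n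
    idconv   : (A : Exp n) (P : Exp (3 + n)) (a : Exp n) (d : Exp (1+ n)) → Exp n

  module ExpApp {T : ℕ → Set} (l : Lift T Exp) where
    open Lift l hiding (var)

    infixl 8 _/_

    _/_ : Exp m → Sub T m n → Exp n
    var x            / ρ = lift (lookup ρ x)
    atom c           / ρ = atom c
    Π A B            / ρ = Π (A / ρ) (B / ρ ↑)
    lam A B t        / ρ = lam (A / ρ) (B / ρ ↑) (t / ρ ↑)
    app A B f a      / ρ = app (A / ρ) (B / ρ ↑) (f / ρ) (a / ρ)
    betaconv A B a t / ρ = betaconv (A / ρ) (B / ρ ↑) (a / ρ) (t / ρ ↑)
    Id A a b         / ρ = Id (A / ρ) (a / ρ) (b / ρ)
    rfl A a          / ρ = rfl (A / ρ) (a / ρ)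
    idrec A P a b p d / ρ = idrec (A / ρ) (P / ρ ↑⋆ 3) (a / ρ) (b / ρ) (p / ρ) (d / ρ ↑)
    idconv A P a d    / ρ = idconv (A / ρ) (P / ρ ↑⋆ 3) (a / ρ) (d / ρ ↑)

    application : Application Exp T
    application = record { _/_ = _/_ }

    open Application application using (_/✶_)

    atom-/✶-↑✶ : ∀ k {c} (ρs : Subs T m n) → atom c /✶ ρs ↑✶ k ≡ atom c
    atom-/✶-↑✶ k ε        = refl
    atom-/✶-↑✶ k (ρ ◅ ρs) = cong (_/ ρ ↑⋆ k) (atom-/✶-↑✶ k ρs)

    Π-/✶-↑✶ : ∀ k {A B} (ρs : Subs T m n) →
              Π A B /✶ ρs ↑✶ k ≡ Π (A /✶ ρs ↑✶ k) (B /✶ ρs ↑✶ (1+ k))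
    Π-/✶-↑✶ k ε        = refl
    Π-/✶-↑✶ k (ρ ◅ ρs) = cong (_/ ρ ↑⋆ k) (Π-/✶-↑✶ k ρs)

    lam-/✶-↑✶ : ∀ k {A B t} (ρs : Subs T m n) →
                lam A B t /✶ ρs ↑✶ k ≡
                lam (A /✶ ρs ↑✶ k) (B /✶ ρs ↑✶ (1+ k)) (t /✶ ρs ↑✶ (1+ k))
    lam-/✶-↑✶ k ε        = refl
    lam-/✶-↑✶ k (ρ ◅ ρs) = cong (_/ ρ ↑⋆ k) (lam-/✶-↑✶ k ρs)

    app-/✶-↑✶ : ∀ k {A B f a} (ρs : Subs T m n) →
                app A B f a /✶ ρs ↑✶ k ≡
                app (A /✶ ρs ↑✶ k) (B /✶ ρs ↑✶ (1+ k)) (f /✶ ρs ↑✶ k) (a /✶ ρs ↑✶ k)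
    app-/✶-↑✶ k ε        = refl
    app-/✶-↑✶ k (ρ ◅ ρs) = cong (_/ ρ ↑⋆ k) (app-/✶-↑✶ k ρs)

    betaconv-/✶-↑✶ : ∀ k {A B a t} (ρs : Subs T m n) →
                     betaconv A B a t /✶ ρs ↑✶ k ≡
                     betaconv (A /✶ ρs ↑✶ k) (B /✶ ρs ↑✶ (1+ k)) (a /✶ ρs ↑✶ k) (t /✶ ρs ↑✶ (1+ k))
    betaconv-/✶-↑✶ k ε        = refl
    betaconv-/✶-↑✶ k (ρ ◅ ρs) = cong (_/ ρ ↑⋆ k) (betaconv-/✶-↑✶ k ρs)

    Id-/✶-↑✶ : ∀ k {A a b} (ρs : Subs T m n) →
               Id A a b /✶ ρs ↑✶ k ≡ Id (A /✶ ρs ↑✶ k) (a /✶ ρs ↑✶ k) (b /✶ ρs ↑✶ k)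
    Id-/✶-↑✶ k ε        = refl
    Id-/✶-↑✶ k (ρ ◅ ρs) = cong (_/ ρ ↑⋆ k) (Id-/✶-↑✶ k ρs)

    rfl-/✶-↑✶ : ∀ k {A a} (ρs : Subs T m n) →
                rfl A a /✶ ρs ↑✶ k ≡ rfl (A /✶ ρs ↑✶ k) (a /✶ ρs ↑✶ k)
    rfl-/✶-↑✶ k ε        = refl
    rfl-/✶-↑✶ k (ρ ◅ ρs) = cong (_/ ρ ↑⋆ k) (rfl-/✶-↑✶ k ρs)

    idrec-/✶-↑✶ : ∀ k {A P a b p d} (ρs : Subs T m n) →
                  idrec A P a b p d /✶ ρs ↑✶ k ≡
                  idrec (A /✶ ρs ↑✶ k) (P /✶ ρs ↑✶ (3 + k)) (a /✶ ρs ↑✶ k) (b /✶ ρs ↑✶ k)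
                        (p /✶ ρs ↑✶ k) (d /✶ ρs ↑✶ (1+ k))
    idrec-/✶-↑✶ k ε        = refl
    idrec-/✶-↑✶ k (ρ ◅ ρs) = cong (_/ ρ ↑⋆ k) (idrec-/✶-↑✶ k ρs)

    idconv-/✶-↑✶ : ∀ k {A P a d} (ρs : Subs T m n) →
                   idconv A P a d /✶ ρs ↑✶ k ≡
                   idconv (A /✶ ρs ↑✶ k) (P /✶ ρs ↑✶ (3 + k)) (a /✶ ρs ↑✶ k) (d /✶ ρs ↑✶ (1+ k))
    idconv-/✶-↑✶ k ε        = refl
    idconv-/✶-↑✶ k (ρ ◅ ρs) = cong (_/ ρ ↑⋆ k) (idconv-/✶-↑✶ k ρs)

  expSubst : TermSubst Exp
  expSubst = record { var = var; app = ExpApp._/_ }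

  module Expₛ = TermSubst expSubst
  open Expₛ hiding (var; app; subst)

  private
    cong₃ : ∀ {A B C D : Set} (f : A → B → C → D) {a a′ b b′ c c′} →
            a ≡ a′ → b ≡ b′ → c ≡ c′ → f a b c ≡ f a′ b′ c′
    cong₃ f refl refl refl = refl

    cong₄ : ∀ {A B C D E : Set} (f : A → B → C → D → E) {a a′ b b′ c c′ d d′} →
            a ≡ a′ → b ≡ b′ → c ≡ c′ → d ≡ d′ → f a b c d ≡ f a′ b′ c′ d′
    cong₄ f refl refl refl refl = refl

    cong₆ : ∀ {A B C D E F G : Set} (h : A → B → C → D → E → F → G)
            {a a′ b b′ c c′ d d′ e e′ f f′} →
            a ≡ a′ → b ≡ b′ → c ≡ c′ → d ≡ d′ → e ≡ e′ → f ≡ f′ →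
            h a b c d e f ≡ h a′ b′ c′ d′ e′ f′
    cong₆ h refl refl refl refl refl refl = refl

  expLemmas : TermLemmas Exp
  expLemmas = record
    { termSubst = expSubst
    ; app-var   = refl
    ; /✶-↑✶     = Lemma./✶-↑✶
    }
    where
    module Lemma {T₁ T₂ : ℕ → Set} {l₁ : Lift T₁ Exp} {l₂ : Lift T₂ Exp} where
      open Expₛ.Lifted l₁ using () renaming (_↑✶_ to _↑✶₁_; _/✶_ to _/✶₁_)
      open Expₛ.Lifted l₂ using () renaming (_↑✶_ to _↑✶₂_; _/✶_ to _/✶₂_)
      module A₁ = ExpApp l₁
      module A₂ = ExpApp l₂

      /✶-↑✶ : (ρs₁ : Subs T₁ m n) (ρs₂ : Subs T₂ m n) →
              (∀ k x → var x /✶₁ ρs₁ ↑✶₁ k ≡ var x /✶₂ ρs₂ ↑✶₂ k) →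
              ∀ k t → t /✶₁ ρs₁ ↑✶₁ k ≡ t /✶₂ ρs₂ ↑✶₂ k
      /✶-↑✶ ρs₁ ρs₂ hyp = go
        where
        go : ∀ k t → t /✶₁ ρs₁ ↑✶₁ k ≡ t /✶₂ ρs₂ ↑✶₂ k
        go k (var x)  = hyp k x
        go k (atom c) = trans (A₁.atom-/✶-↑✶ k ρs₁) (sym (A₂.atom-/✶-↑✶ k ρs₂))
        go k (Π A B)  = trans (A₁.Π-/✶-↑✶ k ρs₁) (trans
          (cong₂ Π (go k A) (go (1+ k) B))
          (sym (A₂.Π-/✶-↑✶ k ρs₂)))
        go k (lam A B t) = trans (A₁.lam-/✶-↑✶ k ρs₁) (trans
          (cong₃ lam (go k A) (go (1+ k) B) (go (1+ k) t))
          (sym (A₂.lam-/✶-↑✶ k ρs₂)))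
        go k (app A B f a) = trans (A₁.app-/✶-↑✶ k ρs₁) (trans
          (cong₄ app (go k A) (go (1+ k) B) (go k f) (go k a))
          (sym (A₂.app-/✶-↑✶ k ρs₂)))
        go k (betaconv A B a t) = trans (A₁.betaconv-/✶-↑✶ k ρs₁) (trans
          (cong₄ betaconv (go k A) (go (1+ k) B) (go k a) (go (1+ k) t))
          (sym (A₂.betaconv-/✶-↑✶ k ρs₂)))
        go k (Id A a b) = trans (A₁.Id-/✶-↑✶ k ρs₁) (trans
          (cong₃ Id (go k A) (go k a) (go k b))
          (sym (A₂.Id-/✶-↑✶ k ρs₂)))
        go k (rfl A a) = trans (A₁.rfl-/✶-↑✶ k ρs₁) (trans
          (cong₂ rfl (go k A) (go k a))
          (sym (A₂.rfl-/✶-↑✶ k ρs₂)))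
        go k (idrec A P a b p d) = trans (A₁.idrec-/✶-↑✶ k ρs₁) (trans
          (cong₆ idrec (go k A) (go (3 + k) P) (go k a) (go k b) (go k p) (go (1+ k) d))
          (sym (A₂.idrec-/✶-↑✶ k ρs₂)))
        go k (idconv A P a d) = trans (A₁.idconv-/✶-↑✶ k ρs₁) (trans
          (cong₄ idconv (go k A) (go (3 + k) P) (go k a) (go (1+ k) d))
          (sym (A₂.idconv-/✶-↑✶ k ρs₂)))

  private module L = TermLemmas expLemmas

  infixl 5 _▹_

  data Ctx : ℕ → Set where
    ∅   : Ctx 0
    _▹_ : Ctx n → Exp n → Ctx (1+ n)

  lookupᶜ : Ctx n → Fin n → Exp n
  lookupᶜ (Γ ▹ A) zero    = weaken A
  lookupᶜ (Γ ▹ A) (suc x) = weaken (lookupᶜ Γ x)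

  -- Γ, x∈A, y∈A, u∈x =_A y

  _▹Id_ : Ctx n → Exp n → Ctx (3 + n)
  Γ ▹Id A = Γ ▹ A ▹ weaken A ▹ Id (weaken (weaken A)) (var (suc zero)) (var zero)

  -- P[a,b,p/x,y,u]

  _[_,_,_] : Exp (3 + n) → Exp n → Exp n → Exp n → Exp n
  P [ a , b , p ] = P / (p ∷ b ∷ a ∷ id)

  -- P[x,x,refl(A,x)/x,y,u] in context Γ, x∈A

  _[refl_] : Exp (3 + n) → Exp n → Exp (1+ n)
  P [refl A ] = P / (rfl (weaken A) (var zero) ∷ var zero ∷ var zero ∷ wk)

  infix 4 ⊢_ctx _⊢_type _⊢_∶_

  -- The premises ‘Γ ⊢ A type’ are the usual presuppositions, made explicit.

  data ⊢_ctx  : Ctx n → Set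
  data _⊢_type (Γ : Ctx n) : Exp n → Set
  data _⊢_∶_   (Γ : Ctx n) : Exp n → Exp n → Set

  data ⊢_ctx where
    ∅   : ⊢ ∅ ctx
    _▹_ : ∀ {Γ : Ctx n} {A} → ⊢ Γ ctx → Γ ⊢ A type → ⊢ Γ ▹ A ctx

  data _⊢_type {n} Γ where
    atom : ∀ {c} → ⊢ Γ ctx → Γ ⊢ atom c type
    Π    : ∀ {A B} → Γ ⊢ A type → Γ ▹ A ⊢ B type → Γ ⊢ Π A B type
    Id   : ∀ {A a b} → Γ ⊢ A type → Γ ⊢ a ∶ A → Γ ⊢ b ∶ A → Γ ⊢ Id A a b type

  data _⊢_∶_ {n} Γ where
    var : ⊢ Γ ctx → (x : Fin n) → Γ ⊢ var x ∶ lookupᶜ Γ x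
    lam : ∀ {A B t} → Γ ⊢ A type → Γ ▹ A ⊢ t ∶ B → Γ ⊢ lam A B t ∶ Π A B
    app : ∀ {A B f a} → Γ ⊢ f ∶ Π A B → Γ ⊢ a ∶ A → Γ ⊢ app A B f a ∶ B / sub a
    betaconv : ∀ {A B a t} → Γ ⊢ A type → Γ ⊢ a ∶ A → Γ ▹ A ⊢ t ∶ B →
               Γ ⊢ betaconv A B a t ∶ Id (B / sub a) (app A B (lam A B t) a) (t / sub a)
    rfl : ∀ {A a} → Γ ⊢ a ∶ A → Γ ⊢ rfl A a ∶ Id A a a
    idrec : ∀ {A P a b p d} → Γ ⊢ A type → Γ ▹Id A ⊢ P type →
            Γ ⊢ p ∶ Id A a b → Γ ▹ A ⊢ d ∶ P [refl A ] →
            Γ ⊢ idrec A P a b p d ∶ P [ a , b , p ]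
    idconv : ∀ {A P a d} → Γ ⊢ A type → Γ ▹Id A ⊢ P type →
             Γ ⊢ a ∶ A → Γ ▹ A ⊢ d ∶ P [refl A ] →
             Γ ⊢ idconv A P a d ∶
               Id (P [ a , a , rfl A a ]) (idrec A P a a (rfl A a) d) (d / sub a)

  infix 4 _⊢*_∶_

  -- The sequence (t₁,…,tₙ) is stored last component first, like a context.

  data _⊢*_∶_ (Δ : Ctx m) : Sub Exp n m → Ctx n → Set where
    []  : Δ ⊢* [] ∶ ∅
    _∷_ : ∀ {t A} {ts : Sub Exp n m} {Γ : Ctx n} →
          Δ ⊢ t ∶ A / ts → Δ ⊢* ts ∶ Γ → Δ ⊢* t ∷ ts ∶ Γ ▹ A

  open ≡-Reasoning

  conv-type : ∀ {Γ : Ctx n} {A B} → A ≡ B → Γ ⊢ A type → Γ ⊢ B type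
  conv-type refl A⊢ = A⊢

  conv-∶ : ∀ {Γ : Ctx n} {t A B} → A ≡ B → Γ ⊢ t ∶ A → Γ ⊢ t ∶ B
  conv-∶ refl t⊢ = t⊢

  map-weaken-⊙-∷ : ∀ (ρ : Sub Exp m n) (t : Exp k) (σ : Sub Exp n k) →
                   map weaken ρ ⊙ (t ∷ σ) ≡ ρ ⊙ σ
  map-weaken-⊙-∷ []      t σ = refl
  map-weaken-⊙-∷ (r ∷ ρ) t σ = cong₂ _∷_ (L.weaken-∷ r) (map-weaken-⊙-∷ ρ t σ)

  ↑⋆3-⊙-∷ : ∀ (ρ : Sub Exp m n) (a b p : Exp k) (σ : Sub Exp n k) →
            ρ ↑⋆ 3 ⊙ (p ∷ b ∷ a ∷ σ) ≡ p ∷ b ∷ a ∷ (ρ ⊙ σ)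
  ↑⋆3-⊙-∷ ρ a b p σ = cong (λ τ → p ∷ b ∷ a ∷ τ)
    (trans (map-weaken-⊙-∷ (map weaken (map weaken ρ)) p (b ∷ a ∷ σ))
    (trans (map-weaken-⊙-∷ (map weaken ρ) b (a ∷ σ))
           (map-weaken-⊙-∷ ρ a σ)))

  /-[,,] : ∀ P {a b p : Exp m} (ρ : Sub Exp m n) →
           P [ a , b , p ] / ρ ≡ (P / ρ ↑⋆ 3) [ a / ρ , b / ρ , p / ρ ]
  /-[,,] P {a} {b} {p} ρ = begin
    P / (p ∷ b ∷ a ∷ id) / ρ                     ≡⟨ L./-⊙ P ⟨
    P / (p / ρ ∷ b / ρ ∷ a / ρ ∷ (id ⊙ ρ))       ≡⟨ cong (λ σ → P / (p / ρ ∷ b / ρ ∷ a / ρ ∷ σ)) (trans L.id-⊙ (sym L.⊙-id)) ⟩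
    P / (p / ρ ∷ b / ρ ∷ a / ρ ∷ (ρ ⊙ id))       ≡⟨ cong (P /_) (↑⋆3-⊙-∷ ρ (a / ρ) (b / ρ) (p / ρ) id) ⟨
    P / (ρ ↑⋆ 3 ⊙ (p / ρ ∷ b / ρ ∷ a / ρ ∷ id))  ≡⟨ L./-⊙ P ⟩
    P / ρ ↑⋆ 3 / (p / ρ ∷ b / ρ ∷ a / ρ ∷ id)    ∎

  /-[refl] : ∀ P (A : Exp m) (ρ : Sub Exp m n) →
             P [refl A ] / ρ ↑ ≡ (P / ρ ↑⋆ 3) [refl A / ρ ]
  /-[refl] P A ρ = begin
    P [refl A ] / ρ ↑                   ≡⟨ L./-⊙ P ⟨
    P / (rfl (weaken A / ρ ↑) x ∷ x ∷ x ∷ (wk ⊙ ρ ↑))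
      ≡⟨ cong₂ (λ B σ → P / (rfl B x ∷ x ∷ x ∷ σ)) (L.weaken-↑ A) (sym L.⊙-wk) ⟩
    P / (r ∷ x ∷ x ∷ (ρ ⊙ wk))          ≡⟨ cong (P /_) (↑⋆3-⊙-∷ ρ x x r wk) ⟨
    P / (ρ ↑⋆ 3 ⊙ (r ∷ x ∷ x ∷ wk))     ≡⟨ L./-⊙ P ⟩
    (P / ρ ↑⋆ 3) [refl A / ρ ]          ∎
    where
    x = var zero
    r = rfl (weaken (A / ρ)) x

  /-map-weaken : ∀ (A : Exp m) (ρ : Sub Exp m n) → A / map weaken ρ ≡ weaken (A / ρ)
  /-map-weaken A ρ = begin
    A / map weaken ρ ≡⟨ cong (A /_) L.map-weaken ⟩
    A / (ρ ⊙ wk)     ≡⟨ L./-⊙ A ⟩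
    A / ρ / wk       ≡⟨ L./-wk {t = A / ρ} ⟩
    weaken (A / ρ)   ∎

  /-IdType : ∀ (A : Exp m) (ρ : Sub Exp m n) →
             Id (weaken (weaken A)) (var (suc zero)) (var zero) / ρ ↑ ↑ ≡
             Id (weaken (weaken (A / ρ))) (var (suc zero)) (var zero)
  /-IdType A ρ = cong (λ B → Id B (var (suc zero)) (var zero))
    (trans (L.weaken-↑ (weaken A)) (cong weaken (L.weaken-↑ A)))

  -- The substitution lemma for any class of substitutions closed under lifting.

  module SubstLemma
    (_⊩_∶_   : ∀ {m n} → Ctx n → Sub Exp m n → Ctx m → Set)
    (⊩-ctx   : ∀ {m n} {Δ : Ctx n} {ρ : Sub Exp m n} {Γ : Ctx m} → Δ ⊩ ρ ∶ Γ → ⊢ Δ ctx)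
    (⊩-var   : ∀ {m n} {Δ : Ctx n} {ρ : Sub Exp m n} {Γ : Ctx m} → Δ ⊩ ρ ∶ Γ →
               ∀ x → Δ ⊢ lookup ρ x ∶ lookupᶜ Γ x / ρ)
    (⊩-wk    : ∀ {m n} {Δ : Ctx n} {ρ : Sub Exp m n} {Γ : Ctx m} {B} → Δ ⊩ ρ ∶ Γ →
               Δ ⊢ B type → (Δ ▹ B) ⊩ map weaken ρ ∶ Γ)
    (⊩-↑     : ∀ {m n} {Δ : Ctx n} {ρ : Sub Exp m n} {Γ : Ctx m} {A} → Δ ⊩ ρ ∶ Γ →
               Δ ⊢ A / ρ type → (Δ ▹ A / ρ) ⊩ ρ ↑ ∶ (Γ ▹ A))
    where

    /-type : ∀ {Γ : Ctx m} {Δ : Ctx n} {ρ A} → Γ ⊢ A type → Δ ⊩ ρ ∶ Γ → Δ ⊢ A / ρ type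
    /-term : ∀ {Γ : Ctx m} {Δ : Ctx n} {ρ t A} → Γ ⊢ t ∶ A → Δ ⊩ ρ ∶ Γ → Δ ⊢ t / ρ ∶ A / ρ
    /-motive : ∀ {Γ : Ctx m} {Δ : Ctx n} {ρ A P} → Γ ⊢ A type → Γ ▹Id A ⊢ P type →
               Δ ⊩ ρ ∶ Γ → Δ ▹Id (A / ρ) ⊢ P / ρ ↑⋆ 3 type

    /-type (atom w)   s = atom (⊩-ctx s)
    /-type (Π A B)    s = let A′ = /-type A s in Π A′ (/-type B (⊩-↑ s A′))
    /-type (Id A a b) s = Id (/-type A s) (/-term a s) (/-term b s)

    /-term (var w x) s = ⊩-var s x
    /-term (lam A t) s = let A′ = /-type A s in lam A′ (/-term t (⊩-↑ s A′))
    /-term {ρ = ρ} (app {A} {B} f a) s =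
      conv-∶ (sym (L.sub-commutes B)) (app (/-term f s) (/-term a s))
    /-term {ρ = ρ} (betaconv {A} {B} {a} {t} A⊢ a⊢ t⊢) s =
      let A′ = /-type A⊢ s in
      conv-∶
        (cong₂ (λ C u → Id C (app A B (lam A B t) a / ρ) u)
          (sym (L.sub-commutes B)) (sym (L.sub-commutes t)))
        (betaconv A′ (/-term a⊢ s) (/-term t⊢ (⊩-↑ s A′)))
    /-term (rfl a) s = rfl (/-term a s)
    /-term {ρ = ρ} (idrec {A} {P} A⊢ P⊢ p⊢ d⊢) s =
      let A′ = /-type A⊢ s in
      conv-∶ (sym (/-[,,] P ρ))
        (idrec A′ (/-motive A⊢ P⊢ s) (/-term p⊢ s)
          (conv-∶ (/-[refl] P A ρ) (/-term d⊢ (⊩-↑ s A′))))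
    /-term {ρ = ρ} (idconv {A} {P} {a} {d} A⊢ P⊢ a⊢ d⊢) s =
      let A′ = /-type A⊢ s in
      conv-∶
        (cong₂ (λ C u → Id C (idrec A P a a (rfl A a) d / ρ) u)
          (sym (/-[,,] P ρ)) (sym (L.sub-commutes d)))
        (idconv A′ (/-motive A⊢ P⊢ s) (/-term a⊢ s)
          (conv-∶ (/-[refl] P A ρ) (/-term d⊢ (⊩-↑ s A′))))

    /-motive {m} {n} {Δ = Δ} {ρ} {A} {P} A⊢ P⊢ s =
      subst (λ C → Δ ▹ A / ρ ▹ weaken (A / ρ) ▹ C ⊢ P / ρ ↑⋆ 3 type) (/-IdType A ρ)
        (/-type P⊢ (⊩-↑ s₂ (conv-type (sym (/-IdType A ρ)) I₂)))
      where
      ρ₁ : Sub Exp m (1+ n)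
      ρ₁ = map weaken ρ
      ρ₂ : Sub Exp m (2 + n)
      ρ₂ = map weaken ρ₁
      A₀ : Δ ⊢ A / ρ type
      A₀ = /-type A⊢ s
      w₁ : (Δ ▹ A / ρ) ⊩ ρ₁ ∶ _
      w₁ = ⊩-wk s A₀
      A₁ : Δ ▹ A / ρ ⊢ weaken (A / ρ) type
      A₁ = conv-type (/-map-weaken A ρ) (/-type A⊢ w₁)
      A₂ : Δ ▹ A / ρ ▹ weaken (A / ρ) ⊢ weaken (weaken (A / ρ)) type
      A₂ = conv-type
             (trans (/-map-weaken A ρ₁) (cong weaken (/-map-weaken A ρ)))
             (/-type A⊢ (⊩-wk w₁ A₁))
      I₂ : Δ ▹ A / ρ ▹ weaken (A / ρ) ⊢ Id (weaken (weaken (A / ρ))) (var (suc zero)) (var zero) type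
      I₂ = Id A₂ (var ctx₂ (suc zero)) (var ctx₂ zero)
        where ctx₂ = (⊩-ctx s ▹ A₀) ▹ A₁
      s₂ : (Δ ▹ A / ρ ▹ weaken (A / ρ)) ⊩ ρ ↑ ↑ ∶ _
      s₂ = subst (λ B → (Δ ▹ A / ρ ▹ B) ⊩ ρ ↑ ↑ ∶ _) (L.weaken-↑ A)
             (⊩-↑ (⊩-↑ s A₀) (conv-type (sym (L.weaken-↑ A)) A₁))

  record Renaming (Δ : Ctx n) (ρ : Sub Exp m n) (Γ : Ctx m) : Set where
    constructor _,_
    field
      ctx   : ⊢ Δ ctx
      image : ∀ x → Σ[ y ∈ Fin n ] lookup ρ x ≡ var y × lookupᶜ Δ y ≡ lookupᶜ Γ x / ρ

  record Typed (Δ : Ctx n) (ρ : Sub Exp m n) (Γ : Ctx m) : Set where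
    constructor _,_
    field
      ctx   : ⊢ Δ ctx
      typed : Δ ⊢* ρ ∶ Γ

  ren-var : ∀ {Δ : Ctx n} {ρ} {Γ : Ctx m} → Renaming Δ ρ Γ → ∀ x → Δ ⊢ lookup ρ x ∶ lookupᶜ Γ x / ρ
  ren-var (w , h) x with y , p , q ← h x =
    conv-∶ q (subst (_ ⊢_∶ _) (sym p) (var w y))

  ren-wk : ∀ {Δ : Ctx n} {ρ} {Γ : Ctx m} {B} → Renaming Δ ρ Γ → Δ ⊢ B type →
           Renaming (Δ ▹ B) (map weaken ρ) Γ
  ren-wk {ρ = ρ} {Γ} (w , h) B⊢ = w ▹ B⊢ , λ x →
    let y , p , q = h x in
    suc y , trans (lookup-map x weaken ρ) (trans (cong weaken p) L.weaken-var)
          , trans (cong weaken q) (sym (/-map-weaken (lookupᶜ Γ x) ρ))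

  ren-↑ : ∀ {Δ : Ctx n} {ρ} {Γ : Ctx m} {A} → Renaming Δ ρ Γ → Δ ⊢ A / ρ type →
          Renaming (Δ ▹ A / ρ) (ρ ↑) (Γ ▹ A)
  ren-↑ {ρ = ρ} {Γ} {A} r A⊢ = Renaming.ctx r ▹ A⊢ , λ where
    zero    → zero , refl , sym (L.weaken-↑ A)
    (suc x) → let y , p , q = Renaming.image (ren-wk r A⊢) x in
              y , p , trans q (trans (/-map-weaken (lookupᶜ Γ x) ρ) (sym (L.weaken-↑ (lookupᶜ Γ x))))

  module Ren = SubstLemma Renaming Renaming.ctx ren-var ren-wk ren-↑

  ren-id : {Γ : Ctx n} → ⊢ Γ ctx → Renaming Γ id Γ
  ren-id {Γ = Γ} w = w , λ x → x , L.lookup-id x , sym (L.id-vanishes (lookupᶜ Γ x))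

  to-weaken : (A : Exp n) → A / map weaken id ≡ weaken A
  to-weaken A = trans (/-map-weaken A id) (cong weaken (L.id-vanishes A))

  weaken-term : ∀ {Γ : Ctx n} {B t A} → ⊢ Γ ctx → Γ ⊢ B type → Γ ⊢ t ∶ A → Γ ▹ B ⊢ weaken t ∶ weaken A
  weaken-term {B = B} {t} {A} w B⊢ t⊢ = conv-∶ (to-weaken A)
    (subst (λ u → _ ▹ B ⊢ u ∶ A / map weaken id) (to-weaken t) (Ren./-term t⊢ (ren-wk (ren-id w) B⊢)))

  sub-var : ∀ {Δ : Ctx n} {ρ} {Γ : Ctx m} → Δ ⊢* ρ ∶ Γ → ∀ x → Δ ⊢ lookup ρ x ∶ lookupᶜ Γ x / ρ
  sub-var (_∷_ {A = A} t⊢ s) zero    = conv-∶ (sym (L.weaken-∷ A)) t⊢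
  sub-var {Γ = Γ ▹ _} (t⊢ ∷ s) (suc x) =
    conv-∶ (sym (L.weaken-∷ (lookupᶜ Γ x))) (sub-var s x)

  sub-wk : ∀ {Δ : Ctx n} {ρ} {Γ : Ctx m} {B} → ⊢ Δ ctx → Δ ⊢* ρ ∶ Γ → Δ ⊢ B type →
           Δ ▹ B ⊢* map weaken ρ ∶ Γ
  sub-wk w []       B⊢ = []
  sub-wk w (_∷_ {A = A} {ts} t⊢ s) B⊢ =
    conv-∶ (sym (/-map-weaken A ts)) (weaken-term w B⊢ t⊢) ∷ sub-wk w s B⊢

  sub-↑ : ∀ {Δ : Ctx n} {ρ} {Γ : Ctx m} {A} → ⊢ Δ ctx → Δ ⊢* ρ ∶ Γ → Δ ⊢ A / ρ type →
          Δ ▹ A / ρ ⊢* ρ ↑ ∶ Γ ▹ A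
  sub-↑ {ρ = ρ} {A = A} w s A⊢ =
    conv-∶ (sym (/-map-weaken A ρ)) (var (w ▹ A⊢) zero) ∷ sub-wk w s A⊢

  typed-var : ∀ {Δ : Ctx n} {ρ} {Γ : Ctx m} → Typed Δ ρ Γ → ∀ x → Δ ⊢ lookup ρ x ∶ lookupᶜ Γ x / ρ
  typed-var (_ , s) = sub-var s

  typed-wk : ∀ {Δ : Ctx n} {ρ} {Γ : Ctx m} {B} → Typed Δ ρ Γ → Δ ⊢ B type →
             Typed (Δ ▹ B) (map weaken ρ) Γ
  typed-wk (w , s) B⊢ = w ▹ B⊢ , sub-wk w s B⊢

  typed-↑ : ∀ {Δ : Ctx n} {ρ} {Γ : Ctx m} {A} → Typed Δ ρ Γ → Δ ⊢ A / ρ type →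
            Typed (Δ ▹ A / ρ) (ρ ↑) (Γ ▹ A)
  typed-↑ (w , s) A⊢ = w ▹ A⊢ , sub-↑ w s A⊢

  module Ty = SubstLemma Typed Typed.ctx typed-var typed-wk typed-↑

  /-type : ∀ {Γ : Ctx m} {Δ : Ctx n} {ρ A} → ⊢ Δ ctx → Δ ⊢* ρ ∶ Γ → Γ ⊢ A type → Δ ⊢ A / ρ type
  /-type w s A⊢ = Ty./-type A⊢ (w , s)

  /-term : ∀ {Γ : Ctx m} {Δ : Ctx n} {ρ t A} → ⊢ Δ ctx → Δ ⊢* ρ ∶ Γ → Γ ⊢ t ∶ A →
           Δ ⊢ t / ρ ∶ A / ρ
  /-term w s t⊢ = Ty./-term t⊢ (w , s)

  ⊢*-id : {Γ : Ctx n} → ⊢ Γ ctx → Γ ⊢* id ∶ Γ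
  ⊢*-wk : {Γ : Ctx n} {A : Exp n} → ⊢ Γ ctx → Γ ⊢ A type → Γ ▹ A ⊢* wk ∶ Γ

  ⊢*-id ∅        = []
  ⊢*-id {Γ = _ ▹ A} (w ▹ A⊢) = conv-∶ (sym (to-weaken A)) (var (w ▹ A⊢) zero) ∷ ⊢*-wk w A⊢
  ⊢*-wk w A⊢ = sub-wk w (⊢*-id w) A⊢

  ⊢*-⊙ : {Θ : Ctx k} {Δ : Ctx m} {Γ : Ctx n} {ts : Sub Exp n m} {us : Sub Exp m k} →
         ⊢ Θ ctx → Δ ⊢* ts ∶ Γ → Θ ⊢* us ∶ Δ → Θ ⊢* ts ⊙ us ∶ Γ
  ⊢*-⊙ w []       u = []
  ⊢*-⊙ w (_∷_ {A = A} t s) u = conv-∶ (sym (L./-⊙ A)) (/-term w u t) ∷ ⊢*-⊙ w s u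

  record Context : Set where
    constructor ⟨_⟩
    field
      {len} : ℕ
      {ctx} : Ctx len
      wf    : ⊢ ctx ctx

  open Context

  record _⟶_ (Δ Γ : Context) : Set where
    constructor ⟪_⟫
    field
      {terms} : Sub Exp (len Γ) (len Δ)
      typed   : ctx Δ ⊢* terms ∶ ctx Γ

  open _⟶_

  classifying : Category 0ℓ 0ℓ 0ℓ
  classifying = record
    { Obj = Context
    ; _⇒_ = _⟶_
    ; _≈_ = λ f g → terms f ≡ terms g
    ; id  = λ {Γ} → ⟪ ⊢*-id (wf Γ) ⟫
    ; _∘_ = λ {Θ} f g → ⟪ ⊢*-⊙ (wf Θ) (typed f) (typed g) ⟫
    ; isEquivalence = record { refl = refl ; sym = sym ; trans = trans }
    ; ∘-resp-≈  = cong₂ _⊙_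
    ; assoc     = sym L.⊙-assoc
    ; identityˡ = L.id-⊙
    ; identityʳ = L.⊙-id
    }

  data IsDisplay : ∀ {Δ Γ} → Δ ⟶ Γ → Set where
    display : ∀ {n} {Γ : Ctx n} {A} (w : ⊢ Γ ctx) (A⊢ : Γ ⊢ A type) →
              IsDisplay {⟨ w ▹ A⊢ ⟩} {⟨ w ⟩} ⟪ ⊢*-wk w A⊢ ⟫

  fibrations : MapClass classifying 0ℓ
  fibrations = record { holds = Closure classifying IsDisplay ; resp-≈ = resp }

{-# OPTIONS --safe #-}
module Submission where

open import Level using (Level; 0ℓ)
open import Data.Nat.Base using (ℕ; _+_) renaming (suc to 1+_)
open import Data.Fin.Base using (zero; suc)
open import Data.Fin.Substitution using (Sub)
open import Data.Fin.Substitution.Lemmas using (TermLemmas)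
open import Data.Product.Base using (Σ-syntax; ∃-syntax; _×_; _,_; proj₁; proj₂)
open import Data.Vec.Base using ([]; _∷_; map; head)
open import Relation.Binary.PropositionalEquality using (_≡_; refl; sym; trans; cong; cong₂; subst)
open import Relation.Binary.Structures using (IsEquivalence)
open import Defs

-- The weak equivalences are the context morphisms f : Δ → Γ with the following weak lifting property:
-- every term of Q[f], for a type Q over Γ, is up to a propositional equality the restriction j[f] of a
-- term j of Q.  Identity elimination says that x ↦ (x, x, refl) is one; Π-types make the class stable under
-- pullback along display maps, hence along all fibrations.  These two facts imply based path induction, so
-- that by induction on Γ every morphism g : Y → Γ factors as a weak equivalence Y → M followed by a
-- fibration M → Y × Γ.  For g = id this is a path object.  The same induction produces homotopy inverses,
-- which give 2-out-of-6, and the factorisation of g reduces pulling back a trivial fibration along g to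
-- pulling back weak equivalences along fibrations.  A section of a trivial fibration f is a diagonal filler
-- of the square with top id and bottom id, obtained by lifting f against itself.

-- Pullbacks and products in an arbitrary category.

module CategoryLemmas {o ℓ e : Level} (C : Category o ℓ e) where
  open Category C

  ≈-refl : ∀ {A B} {f : A ⇒ B} → f ≈ f
  ≈-refl = IsEquivalence.refl isEquivalence

  ≈-sym : ∀ {A B} {f g : A ⇒ B} → f ≈ g → g ≈ f
  ≈-sym = IsEquivalence.sym isEquivalence

  infixr 5 _⨾_

  _⨾_ : ∀ {A B} {f g h : A ⇒ B} → f ≈ g → g ≈ h → f ≈ h
  _⨾_ = IsEquivalence.trans isEquivalence

  infixr 9 _∘ˡ_
  infixl 9 _ʳ∘_

  _∘ˡ_ : ∀ {A B D} (f : B ⇒ D) {g h : A ⇒ B} → g ≈ h → f ∘ g ≈ f ∘ h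
  f ∘ˡ p = ∘-resp-≈ ≈-refl p

  _ʳ∘_ : ∀ {A B D} {f g : B ⇒ D} → f ≈ g → (h : A ⇒ B) → f ∘ h ≈ g ∘ h
  p ʳ∘ h = ∘-resp-≈ p ≈-refl

  flip-pullback : ∀ {P X Y Z} {p₁ : P ⇒ X} {p₂ : P ⇒ Y} {f : X ⇒ Z} {g : Y ⇒ Z} →
                  IsPullback C p₁ p₂ f g → IsPullback C p₂ p₁ g f
  flip-pullback P = record
    { commutes     = ≈-sym commutes
    ; universal    = λ eq → universal (≈-sym eq)
    ; p₁∘universal = λ eq → p₂∘universal (≈-sym eq)
    ; p₂∘universal = λ eq → p₁∘universal (≈-sym eq)
    ; unique       = λ q₁ q₂ → unique q₂ q₁
    }
    where open IsPullback P

  pullback-resp-≈ : ∀ {P X Y Z} {p₁ : P ⇒ X} {p₂ : P ⇒ Y} {f f′ : X ⇒ Z} {g g′ : Y ⇒ Z} → f ≈ f′ → g ≈ g′ →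
                    IsPullback C p₁ p₂ f g → IsPullback C p₁ p₂ f′ g′
  pullback-resp-≈ p q P = record
    { commutes     = ≈-sym p ʳ∘ _ ⨾ commutes ⨾ q ʳ∘ _
    ; universal    = λ eq → universal (p ʳ∘ _ ⨾ eq ⨾ ≈-sym q ʳ∘ _)
    ; p₁∘universal = λ eq → p₁∘universal _
    ; p₂∘universal = λ eq → p₂∘universal _
    ; unique       = unique
    }
    where open IsPullback P

  paste : ∀ {P Q W X Y Z} {p₁ : P ⇒ Q} {p₂ : P ⇒ Y} {q₁ : Q ⇒ W} {q₂ : Q ⇒ X} {f : W ⇒ Z} {g : X ⇒ Z} {h : Y ⇒ X} →
          IsPullback C q₁ q₂ f g → IsPullback C p₁ p₂ q₂ h → IsPullback C (q₁ ∘ p₁) p₂ f (g ∘ h)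
  paste {p₁ = p₁} {p₂} {q₁} {q₂} {f} {g} {h} Q P = record
    { commutes     = ≈-sym assoc ⨾ Q.commutes ʳ∘ _ ⨾ assoc ⨾ g ∘ˡ P.commutes ⨾ ≈-sym assoc
    ; universal    = λ eq → P.universal (q₂∘ eq)
    ; p₁∘universal = λ eq → assoc ⨾ q₁ ∘ˡ P.p₁∘universal (q₂∘ eq) ⨾ Q.p₁∘universal _
    ; p₂∘universal = λ eq → P.p₂∘universal (q₂∘ eq)
    ; unique       = λ e₁ e₂ → P.unique
        (Q.unique (≈-sym assoc ⨾ e₁ ⨾ assoc)
                  (≈-sym assoc ⨾ P.commutes ʳ∘ _ ⨾ assoc ⨾ h ∘ˡ e₂ ⨾ ≈-sym assoc ⨾ ≈-sym P.commutes ʳ∘ _ ⨾ assoc))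
        e₂
    }
    where
    module P = IsPullback P
    module Q = IsPullback Q
    q₂∘ : ∀ {A} {k : A ⇒ _} {l : A ⇒ _} (eq : f ∘ k ≈ (g ∘ h) ∘ l) → q₂ ∘ Q.universal (eq ⨾ assoc) ≈ h ∘ l
    q₂∘ eq = Q.p₂∘universal (eq ⨾ assoc)

  module _ {P Q X Y Z} {p₁ : P ⇒ X} {p₂ : P ⇒ Y} {q₁ : Q ⇒ X} {q₂ : Q ⇒ Y} {f : X ⇒ Z} {g : Y ⇒ Z}
           (isP : IsPullback C p₁ p₂ f g) (isQ : IsPullback C q₁ q₂ f g) where
    private
      module P = IsPullback isP
      module Q = IsPullback isQ

    compare : P ⇒ Q
    compare = Q.universal P.commutes

    q₁∘compare : q₁ ∘ compare ≈ p₁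
    q₁∘compare = Q.p₁∘universal P.commutes

    q₂∘compare : q₂ ∘ compare ≈ p₂
    q₂∘compare = Q.p₂∘universal P.commutes

    -- The axioms of a path category speak of arbitrary pullback squares. Through this isomorphism
    -- they follow from the case of one chosen pullback.
    compare-iso : IsIso C compare
    compare-iso = record
      { inv  = back
      ; isoˡ = P.unique (≈-sym assoc ⨾ P.p₁∘universal _ ʳ∘ _ ⨾ q₁∘compare ⨾ ≈-sym identityʳ)
                        (≈-sym assoc ⨾ P.p₂∘universal _ ʳ∘ _ ⨾ q₂∘compare ⨾ ≈-sym identityʳ)
      ; isoʳ = Q.unique (≈-sym assoc ⨾ q₁∘compare ʳ∘ _ ⨾ P.p₁∘universal _ ⨾ ≈-sym identityʳ)
                        (≈-sym assoc ⨾ q₂∘compare ʳ∘ _ ⨾ P.p₂∘universal _ ⨾ ≈-sym identityʳ)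
      }
      where
      back : Q ⇒ P
      back = P.universal Q.commutes

  module _ {X Y} (P Q : Product C X Y) where
    private
      module P = Product P
      module Q = Product Q

    product-compare : P.X×Y ⇒ Q.X×Y
    product-compare = Q.⟨ P.π₁ , P.π₂ ⟩

    product-compare-iso : IsIso C product-compare
    product-compare-iso = record
      { inv  = P.⟨ Q.π₁ , Q.π₂ ⟩
      ; isoˡ = P.unique (≈-sym assoc ⨾ P.π₁∘⟨⟩ ʳ∘ _ ⨾ Q.π₁∘⟨⟩ ⨾ ≈-sym identityʳ)
                        (≈-sym assoc ⨾ P.π₂∘⟨⟩ ʳ∘ _ ⨾ Q.π₂∘⟨⟩ ⨾ ≈-sym identityʳ)
      ; isoʳ = Q.unique (≈-sym assoc ⨾ Q.π₁∘⟨⟩ ʳ∘ _ ⨾ P.π₁∘⟨⟩ ⨾ ≈-sym identityʳ)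
                        (≈-sym assoc ⨾ Q.π₂∘⟨⟩ ʳ∘ _ ⨾ P.π₂∘⟨⟩ ⨾ ≈-sym identityʳ)
      }

  -- Presents a product projection as a pullback of a map to the terminal object, so that it is a
  -- fibration once all maps to the terminal object are.
  product-pullback : ∀ {⊤ X Y} (⊤! : IsTerminal C ⊤) (P : Product C X Y) →
                     IsPullback C (Product.π₁ P) (Product.π₂ P) (IsTerminal.! ⊤!) (IsTerminal.! ⊤!)
  product-pullback ⊤! P = record
    { commutes     = !-unique _ ⨾ ≈-sym (!-unique _)
    ; universal    = λ {_} {h} {k} _ → ⟨ h , k ⟩
    ; p₁∘universal = λ _ → π₁∘⟨⟩
    ; p₂∘universal = λ _ → π₂∘⟨⟩
    ; unique       = unique
    }
    where
    open IsTerminal ⊤!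
    open Product P

  -- With `p` a display map, this turns a product with a context into a product with that context
  -- extended by one variable. The factorisation of a morphism builds its product in this way.
  product-along : ∀ {X Y E Q} {p : E ⇒ Y} {q₁ : Q ⇒ E} (P : Product C X Y) {q₂ : Q ⇒ Product.X×Y P} →
                  IsPullback C q₁ q₂ p (Product.π₂ P) → Product C X E
  product-along {p = p} {q₁} P {q₂} isQ = record
    { π₁     = π₁ ∘ q₂
    ; π₂     = q₁
    ; ⟨_,_⟩  = λ h k → Q.universal (≈-sym (π₂∘⟨⟩ {h = h} {p ∘ k}))
    ; π₁∘⟨⟩  = assoc ⨾ π₁ ∘ˡ Q.p₂∘universal _ ⨾ π₁∘⟨⟩
    ; π₂∘⟨⟩  = Q.p₁∘universal _
    ; unique = λ e₁ e₂ → Q.unique e₂ (unique (≈-sym assoc ⨾ e₁ ⨾ assoc)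
        (≈-sym assoc ⨾ ≈-sym Q.commutes ʳ∘ _ ⨾ assoc ⨾ p ∘ˡ e₂ ⨾ ≈-sym assoc ⨾ Q.commutes ʳ∘ _ ⨾ assoc))
    }
    where
    module Q = IsPullback isQ
    open Product P

  id-iso : ∀ {A} → IsIso C (id {A})
  id-iso = record { inv = id ; isoˡ = identityˡ ; isoʳ = identityˡ }

-- Substitution identities and presuppositions of the judgements.

module Syntactic (Atom : Set) where
  open ObjectiveTypeTheory Atom public
  open Expₛ hiding (var; app; subst) public
  module L = TermLemmas expLemmas

  private variable
    k l m n : ℕ
    Γ Δ Θ Ξ : Ctx n

  x₀ : Exp (1+ n)
  x₀ = var zero
  x₁ : Exp (2 + n)
  x₁ = var (suc zero)
  x₂ : Exp (3 + n)
  x₂ = var (suc (suc zero))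
  x₃ : Exp (4 + n)
  x₃ = var (suc (suc (suc zero)))
  x₄ : Exp (5 + n)
  x₄ = var (suc (suc (suc (suc zero))))

  wk² : Sub Exp n (2 + n)
  wk² = map weaken wk
  wk³ : Sub Exp n (3 + n)
  wk³ = map weaken wk²
  wk⁴ : Sub Exp n (4 + n)
  wk⁴ = map weaken wk³
  wk⁵ : Sub Exp n (5 + n)
  wk⁵ = map weaken wk⁴

  weaken²-∷ : ∀ (A : Exp n) {a b : Exp m} {σ} → weaken (weaken A) / (b ∷ a ∷ σ) ≡ A / σ
  weaken²-∷ A = trans (L.weaken-∷ (weaken A)) (L.weaken-∷ A)

  weaken-/-↑ : ∀ (A : Exp n) (ρ : Sub Exp n m) → weaken A / ρ ↑ ≡ weaken (A / ρ)
  weaken-/-↑ A ρ = L.weaken-↑ A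

  wk-⊙-∷ : ∀ {t : Exp m} {σ : Sub Exp n m} → wk ⊙ (t ∷ σ) ≡ σ
  wk-⊙-∷ {t = t} {σ} = L.wk-⊙-∷ t σ

  ↑-⊙-∷ : ∀ (ρ : Sub Exp k m) {t : Exp n} {σ} → ρ ↑ ⊙ (t ∷ σ) ≡ t ∷ ρ ⊙ σ
  ↑-⊙-∷ ρ {t} {σ} = cong (t ∷_) (map-weaken-⊙-∷ ρ t σ)

  /-↑-∷ : ∀ (B : Exp (1+ k)) (ρ : Sub Exp k m) {t : Exp n} {σ} → B / ρ ↑ / (t ∷ σ) ≡ B / (t ∷ ρ ⊙ σ)
  /-↑-∷ B ρ {t} {σ} = trans (sym (L./-⊙ B)) (cong (B /_) (↑-⊙-∷ ρ))

  /-↑-sub : ∀ (B : Exp (1+ k)) (ρ : Sub Exp k m) {t : Exp m} → B / ρ ↑ / sub t ≡ B / (t ∷ ρ)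
  /-↑-sub B ρ {t} = trans (/-↑-∷ B ρ) (cong (λ σ → B / (t ∷ σ)) L.⊙-id)

  /-wk↑-∷ : ∀ (B : Exp (1+ n)) {t u : Exp m} {σ} → B / wk ↑ / (t ∷ u ∷ σ) ≡ B / (t ∷ σ)
  /-wk↑-∷ B {t} = trans (/-↑-∷ B wk) (cong (λ σ → B / (t ∷ σ)) wk-⊙-∷)

  /-[refl]-∷ : ∀ P (A : Exp n) {a : Exp m} {σ} →
               P [refl A ] / (a ∷ σ) ≡ P / (rfl (A / σ) a ∷ a ∷ a ∷ σ)
  /-[refl]-∷ P A {a} {σ} = trans (sym (L./-⊙ P))
    (cong₂ (λ B τ → P / (rfl B a ∷ a ∷ a ∷ τ)) (L.weaken-∷ A) wk-⊙-∷)

  type-ctx : ∀ {A} → Γ ⊢ A type → ⊢ Γ ctx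
  type-ctx (atom w)    = w
  type-ctx (Π A _)     = type-ctx A
  type-ctx (Id A _ _)  = type-ctx A

  term-ctx : ∀ {t A} → Γ ⊢ t ∶ A → ⊢ Γ ctx
  term-ctx (var w _)          = w
  term-ctx (lam A _)          = type-ctx A
  term-ctx (app f _)          = term-ctx f
  term-ctx (betaconv A _ _)   = type-ctx A
  term-ctx (rfl a)            = term-ctx a
  term-ctx (idrec A _ _ _)    = type-ctx A
  term-ctx (idconv A _ _ _)   = type-ctx A

  weaken-type : ∀ {A B} → Γ ⊢ B type → Γ ⊢ A type → Γ ▹ B ⊢ weaken A type
  weaken-type {A = A} B⊢ A⊢ =
    conv-type (to-weaken A) (/-type (w ▹ B⊢) (⊢*-wk w B⊢) A⊢)
    where w = type-ctx A⊢

  ⊢*-sub : ∀ {a A} → Γ ⊢ a ∶ A → Γ ⊢* sub a ∶ Γ ▹ A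
  ⊢*-sub {A = A} a⊢ = conv-∶ (sym (L.id-vanishes A)) a⊢ ∷ ⊢*-id (term-ctx a⊢)

  ⊢*-Id : ∀ {σ : Sub Exp n m} {A a b p} → Δ ⊢* σ ∶ Γ → Δ ⊢ a ∶ A / σ → Δ ⊢ b ∶ A / σ →
          Δ ⊢ p ∶ Id (A / σ) a b → Δ ⊢* p ∷ b ∷ a ∷ σ ∶ Γ ▹Id A
  ⊢*-Id {A = A} {a} {b} s a⊢ b⊢ p⊢ =
    conv-∶ (cong (λ B → Id B a b) (sym (weaken²-∷ A))) p⊢ ∷
    conv-∶ (sym (L.weaken-∷ A)) b⊢ ∷ a⊢ ∷ s

  Id-endpoints : ∀ {A a b} → Γ ⊢ Id A a b type → Γ ⊢ A type × Γ ⊢ a ∶ A × Γ ⊢ b ∶ A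
  Id-endpoints (Id A a b) = A , a , b

  private
    ⊢*-[,,] : ∀ {A a b p} → Γ ⊢ a ∶ A → Γ ⊢ b ∶ A → Γ ⊢ p ∶ Id A a b →
              Γ ⊢* p ∷ b ∷ a ∷ id ∶ Γ ▹Id A
    ⊢*-[,,] {A = A} {a} {b} a⊢ b⊢ p⊢ =
      ⊢*-Id (⊢*-id (term-ctx a⊢)) (conv-∶ id≡ a⊢) (conv-∶ id≡ b⊢)
        (conv-∶ (cong (λ B → Id B a b) id≡) p⊢)
      where id≡ = sym (L.id-vanishes A)

  lookup-type : ⊢ Γ ctx → ∀ x → Γ ⊢ lookupᶜ Γ x type
  lookup-type (w ▹ A) zero    = weaken-type A A
  lookup-type (w ▹ A) (suc x) = weaken-type A (lookup-type w x)

  -- The term rules record few presuppositions. Matching the result against the formation rule `Id`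
  -- recovers, from a path alone, the derivations of its type and of its endpoints.
  term-type : ∀ {t A} → Γ ⊢ t ∶ A → Γ ⊢ A type
  term-type (var w x)   = lookup-type w x
  term-type (lam A t)   = Π A (term-type t)
  term-type (app f a) with Π A B ← term-type f = /-type (term-ctx a) (⊢*-sub a) B
  term-type (betaconv A a t) =
    Id (/-type w s (term-type t)) (app (lam A t) a) (/-term w s t)
    where
    w = term-ctx a
    s = ⊢*-sub a
  term-type (rfl a) = Id (term-type a) a a
  term-type (idrec A P p d) =
    let _ , a , b = Id-endpoints (term-type p) in
    /-type (term-ctx p) (⊢*-[,,] a b p) P
  term-type (idconv {A} {P} A⊢ P⊢ a⊢ d⊢) =
    Id (/-type w (⊢*-[,,] a⊢ a⊢ (rfl a⊢)) P⊢) (idrec A⊢ P⊢ (rfl a⊢) d⊢)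
       (conv-∶ (trans (/-[refl]-∷ P A) (cong (λ B → P [ _ , _ , rfl B _ ]) (L.id-vanishes A)))
         (/-term w (⊢*-sub a⊢) d⊢))
    where w = term-ctx a⊢

  var₀ : ∀ {A} → Γ ⊢ A type → Γ ▹ A ⊢ var zero ∶ weaken A
  var₀ A = var (type-ctx A ▹ A) zero

  ctx-Id : ∀ {A} → Γ ⊢ A type → ⊢ Γ ▹Id A ctx
  ctx-Id A = ((type-ctx A ▹ A) ▹ A₁) ▹ Id (weaken-type A₁ A₁) (var w (suc zero)) (var w zero)
    where
    A₁ = weaken-type A A
    w  = (type-ctx A ▹ A) ▹ A₁

  -- Transport and the operations on paths.

  wk³-⊙-∷ : ∀ {a b p : Exp m} {σ : Sub Exp n m} → wk³ ⊙ (p ∷ b ∷ a ∷ σ) ≡ σ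
  wk³-⊙-∷ {a = a} {b} {p} {σ} = trans (map-weaken-⊙-∷ _ p _) (trans (map-weaken-⊙-∷ _ b _) wk-⊙-∷)

  -- In `Γ ▹Id A` the generic path `x₀` runs from `x₂` to `x₁`, so `x₂ ∷ wk³` and `x₁ ∷ wk³`
  -- evaluate a family at its two endpoints.
  /-endpoint₁ : ∀ (F : Exp (1+ n)) {a b p : Exp m} {σ} → F / (x₂ ∷ wk³) / (p ∷ b ∷ a ∷ σ) ≡ F / (a ∷ σ)
  /-endpoint₁ F {a} {b} {p} {σ} = trans (sym (L./-⊙ F)) (cong (λ τ → F / (a ∷ τ)) (wk³-⊙-∷ {a = a} {b} {p} {σ}))

  /-endpoint₂ : ∀ (F : Exp (1+ n)) {a b p : Exp m} {σ} → F / (x₁ ∷ wk³) / (p ∷ b ∷ a ∷ σ) ≡ F / (b ∷ σ)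
  /-endpoint₂ F {a} {b} {p} {σ} = trans (sym (L./-⊙ F)) (cong (λ τ → F / (b ∷ τ)) (wk³-⊙-∷ {a = a} {b} {p} {σ}))

  ⊢*-wk³ : ∀ {A} → Γ ⊢ A type → Γ ▹Id A ⊢* wk³ ∶ Γ
  ⊢*-wk³ A with ctx-Id A
  ... | (w ▹ A₀) ▹ A₁ ▹ I = sub-wk (w ▹ A₀ ▹ A₁) (sub-wk (w ▹ A₀) (⊢*-wk w A₀) A₁) I

  /-wk³ : ∀ (A : Exp n) → weaken (weaken (weaken A)) ≡ A / wk³
  /-wk³ A = sym (trans (/-map-weaken A _) (cong weaken
              (trans (/-map-weaken A _) (cong weaken (L./-wk {t = A})))))

  ⊢*-endpoint₁ : ∀ {A} → Γ ⊢ A type → Γ ▹Id A ⊢* x₂ ∷ wk³ ∶ Γ ▹ A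
  ⊢*-endpoint₁ {A = A} A⊢ = conv-∶ (/-wk³ A) (var (ctx-Id A⊢) (suc (suc zero))) ∷ ⊢*-wk³ A⊢

  ⊢*-endpoint₂ : ∀ {A} → Γ ⊢ A type → Γ ▹Id A ⊢* x₁ ∷ wk³ ∶ Γ ▹ A
  ⊢*-endpoint₂ {A = A} A⊢ = conv-∶ (/-wk³ A) (var (ctx-Id A⊢) (suc zero)) ∷ ⊢*-wk³ A⊢

  -- Identity elimination into the function type from `F` at the first endpoint to `F` at the
  -- second, starting from the identity function; the resulting function is applied to `u`.
  transport : ∀ {A F a b p u} → Γ ▹ A ⊢ F type → Γ ⊢ p ∶ Id A a b → Γ ⊢ u ∶ F / sub a →
              ∃[ v ] Γ ⊢ v ∶ F / sub b
  transport {Γ = Γ} {A = A} {F} {a} {b} {p} {u} F⊢ p⊢ u⊢ with Id A⊢ a⊢ b⊢ ← term-type p⊢ =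
    _ , conv-∶ eq₂ (app (conv-∶ eq₁ J) u⊢)
    where
    w  = type-ctx A⊢
    F₁ = /-type (ctx-Id A⊢) (⊢*-endpoint₁ A⊢) F⊢
    F₂ = /-type (ctx-Id A⊢) (⊢*-endpoint₂ A⊢) F⊢
    P = Π (F / (x₂ ∷ wk³)) (weaken (F / (x₁ ∷ wk³)))
    P⊢ : Γ ▹Id A ⊢ P type
    P⊢ = Π F₁ (weaken-type F₁ F₂)
    d⊢ : Γ ▹ A ⊢ lam F (weaken F) x₀ ∶ P [refl A ]
    d⊢ = conv-∶
           (cong₂ Π (sym (trans (/-endpoint₁ F) (L.id-vanishes F)))
             (sym (trans (weaken-/-↑ (F / (x₁ ∷ wk³)) (rfl (weaken A) x₀ ∷ x₀ ∷ x₀ ∷ wk))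
               (cong weaken (trans (/-endpoint₂ F) (L.id-vanishes F))))))
           (lam F⊢ (var₀ F⊢))
    J = idrec A⊢ P⊢ p⊢ d⊢
    eq₁ : P [ a , b , p ] ≡ Π (F / sub a) (weaken (F / sub b))
    eq₁ = cong₂ Π (/-endpoint₁ F) (trans (weaken-/-↑ (F / (x₁ ∷ wk³)) (p ∷ b ∷ a ∷ id)) (cong weaken (/-endpoint₂ F)))
    eq₂ : weaken (F / sub b) / sub u ≡ F / sub b
    eq₂ = trans (L.weaken-∷ (F / sub b)) (L.id-vanishes _)

  Path : Ctx n → (A a b : Exp n) → Set
  Path Γ A a b = ∃[ p ] Γ ⊢ p ∶ Id A a b

  reflᵖ : ∀ {A a} → Γ ⊢ a ∶ A → Path Γ A a a
  reflᵖ a = _ , rfl a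

  convᵖ : ∀ {A A′ a a′ b b′} → A ≡ A′ → a ≡ a′ → b ≡ b′ → Path Γ A a b → Path Γ A′ a′ b′
  convᵖ refl refl refl p = p

  -- Transport of reflexivity in the family `t a = t y`. In the same way `symᵖ` transports
  -- reflexivity in the family `y = a`, and `transᵖ` transports its first path along its second in
  -- the family `a = y`.
  congᵖ : ∀ {A B a b t} → Γ ▹ A ⊢ t ∶ weaken B → Path Γ A a b → Path Γ B (t / sub a) (t / sub b)
  congᵖ {A = A} {B} {a} {b} {t} t⊢ (p , p⊢) with Id A⊢ a⊢ b⊢ ← term-type p⊢ =
    _ , conv-∶ (eq _) (proj₂ (transport F⊢ p⊢ (conv-∶ (sym (eq _)) (rfl ta⊢))))
    where
    w = term-ctx p⊢
    ta⊢ : _ ⊢ t / sub a ∶ B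
    ta⊢ = conv-∶ (L.weaken-sub B) (/-term w (⊢*-sub a⊢) t⊢)
    F⊢ : _ ▹ A ⊢ Id (weaken B) (weaken (t / sub a)) t type
    F⊢ = Id (term-type t⊢) (weaken-term w A⊢ ta⊢) t⊢
    eq : ∀ c → Id (weaken B) (weaken (t / sub a)) t / sub c ≡ Id B (t / sub a) (t / sub c)
    eq c = cong₂ (λ C u → Id C u (t / sub c)) (L.weaken-sub B) (L.weaken-sub (t / sub a))

  symᵖ : ∀ {A a b} → Path Γ A a b → Path Γ A b a
  symᵖ {A = A} {a} {b} (p , p⊢) with Id A⊢ a⊢ b⊢ ← term-type p⊢ =
    _ , conv-∶ (eq b) (proj₂ (transport (Id A₁ (var₀ A⊢) (weaken-term w A⊢ a⊢)) p⊢ (conv-∶ (sym (eq a)) (rfl a⊢))))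
    where
    w = term-ctx p⊢
    A₁ = weaken-type A⊢ A⊢
    eq : ∀ c → Id (weaken A) x₀ (weaken a) / sub c ≡ Id A c a
    eq c = cong₂ (λ B u → Id B c u) (L.weaken-sub A) (L.weaken-sub a)

  transᵖ : ∀ {A a b c} → Path Γ A a b → Path Γ A b c → Path Γ A a c
  transᵖ {A = A} {a} {b} {c} (p , p⊢) (q , q⊢) with Id A⊢ a⊢ b⊢ ← term-type p⊢ =
    _ , conv-∶ (eq c) (proj₂ (transport (Id A₁ (weaken-term w A⊢ a⊢) (var₀ A⊢)) q⊢ (conv-∶ (sym (eq b)) p⊢)))
    where
    w = term-ctx p⊢
    A₁ = weaken-type A⊢ A⊢
    eq : ∀ d → Id (weaken A) (weaken a) x₀ / sub d ≡ Id A a d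
    eq d = cong₂ (λ B u → Id B u d) (L.weaken-sub A) (L.weaken-sub a)

  /ᵖ : ∀ {ρ : Sub Exp n m} {A a b} → ⊢ Δ ctx → Δ ⊢* ρ ∶ Γ → Path Γ A a b → Path Δ (A / ρ) (a / ρ) (b / ρ)
  /ᵖ w s (p , p⊢) = _ , /-term w s p⊢

  congᵖ-∷ : ∀ {σ : Sub Exp n m} {A} B {a b t} → Δ ⊢* σ ∶ Γ → Γ ▹ A ⊢ t ∶ weaken B →
            Path Δ (A / σ) a b → Path Δ (B / σ) (t / (a ∷ σ)) (t / (b ∷ σ))
  congᵖ-∷ {σ = σ} B {t = t} s t⊢ (p , p⊢) with Id A⊢ _ _ ← term-type p⊢ =
    convᵖ refl (/-↑-sub t σ) (/-↑-sub t σ)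
      (congᵖ (conv-∶ (L.weaken-↑ B) (/-term (w ▹ A⊢) (sub-↑ w s A⊢) t⊢)) (p , p⊢))
    where w = term-ctx p⊢

  /-↑⋆-⊙ : ∀ k (B : Exp (k + l)) {ρ : Sub Exp l m} {σ : Sub Exp m n} → B / ρ ↑⋆ k / σ ↑⋆ k ≡ B / (ρ ⊙ σ) ↑⋆ k
  /-↑⋆-⊙ k B = trans (sym (L./-⊙ B)) (cong (B /_) (sym (L.↑⋆-distrib k)))

  -- Weak equivalences: composition, isomorphisms and reflexivity.

  record WeakEq (Δ : Ctx m) (f : Sub Exp n m) (Γ : Ctx n) : Set where
    field
      dom   : ⊢ Δ ctx
      cod   : ⊢ Γ ctx
      typed : Δ ⊢* f ∶ Γ
      lift  : ∀ Q {d} → Γ ⊢ Q type → Δ ⊢ d ∶ Q / f → ∃[ j ] Γ ⊢ j ∶ Q × Path Δ (Q / f) (j / f) d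

  open WeakEq public

  -- Lifting along `f` happens first, against the reindexed type `Q / g₀`, and then along `g`. The
  -- path obtained from `g` is restricted along `f` and composed with the one from `f`.
  weq-∘ : ∀ {g : Sub Exp l n} {f : Sub Exp n m} → WeakEq Γ g Θ → WeakEq Δ f Γ → WeakEq Δ (g ⊙ f) Θ
  weq-∘ g f .dom = dom f
  weq-∘ g f .cod = cod g
  weq-∘ g f .typed = ⊢*-⊙ (dom f) (typed g) (typed f)
  weq-∘ {g = g₀} {f₀} g f .lift Q {d} Q⊢ d⊢ =
    let j , j⊢ , p = lift f (Q / g₀) (/-type (dom g) (typed g) Q⊢) (conv-∶ (L./-⊙ Q) d⊢)
        i , i⊢ , q = lift g Q Q⊢ j⊢
    in i , i⊢ , convᵖ (sym (L./-⊙ Q)) (sym (L./-⊙ i)) refl (transᵖ (/ᵖ (dom f) (typed f) q) p)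

  weq-iso : ∀ {f : Sub Exp n m} {g : Sub Exp m n} → ⊢ Δ ctx → ⊢ Γ ctx → Δ ⊢* f ∶ Γ → Γ ⊢* g ∶ Δ →
            f ⊙ g ≡ id → g ⊙ f ≡ id → WeakEq Δ f Γ
  weq-iso wΔ wΓ f⊢ g⊢ fg gf .dom = wΔ
  weq-iso wΔ wΓ f⊢ g⊢ fg gf .cod = wΓ
  weq-iso wΔ wΓ f⊢ g⊢ fg gf .typed = f⊢
  weq-iso {f = f} {g} wΔ wΓ f⊢ g⊢ fg gf .lift Q {d} Q⊢ d⊢ =
    d / g , conv-∶ (trans (sym (L./-⊙ Q)) (trans (cong (Q /_) fg) (L.id-vanishes Q))) (/-term wΓ g⊢ d⊢) ,
    convᵖ refl (sym (trans (sym (L./-⊙ d)) (trans (cong (d /_) gf) (L.id-vanishes d)))) refl (reflᵖ d⊢)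

  reflexivity : Exp n → Sub Exp (3 + n) (1+ n)
  reflexivity A = rfl (weaken A) x₀ ∷ x₀ ∷ x₀ ∷ wk

  -- The lift is `idrec` at the generic path with motive `Q`, and the required path is the
  -- computation rule `idconv`. What remains is to match the substitutions on both sides.
  weq-reflexivity : ∀ {A} → Γ ⊢ A type → WeakEq (Γ ▹ A) (reflexivity A) (Γ ▹Id A)
  weq-reflexivity A⊢ .dom = type-ctx A⊢ ▹ A⊢
  weq-reflexivity A⊢ .cod = ctx-Id A⊢
  weq-reflexivity {A = A} A⊢ .typed =
    ⊢*-Id (⊢*-wk (type-ctx A⊢) A⊢) x⊢ x⊢ (conv-∶ (cong (λ B → Id B x₀ x₀) (sym (L./-wk {t = A}))) (rfl (var₀ A⊢)))
    where x⊢ = conv-∶ (sym (L./-wk {t = A})) (var₀ A⊢)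
  weq-reflexivity {n} {Γ} {A = A} A⊢ .lift Q {d} Q⊢ d⊢ = _ , j⊢ , _ , e⊢
    where
    ρ  = wk³ {n}
    A³ = A / ρ
    A³⊢ : Γ ▹Id A ⊢ A³ type
    A³⊢ = /-type (ctx-Id A⊢) (⊢*-wk³ A⊢) A⊢
    Q³⊢ = Ty./-motive A⊢ Q⊢ (ctx-Id A⊢ , ⊢*-wk³ A⊢)
    d³⊢ = conv-∶ (/-[refl] Q A ρ) (/-term (ctx-Id A⊢ ▹ A³⊢) (sub-↑ (ctx-Id A⊢) (⊢*-wk³ A⊢) A³⊢) d⊢)
    -- The eliminator is used in the context `Γ ▹Id A` itself, so its parameters, which live over
    -- `Γ`, are first weakened past the three new variables.
    j⊢ : Γ ▹Id A ⊢ idrec A³ (Q / ρ ↑⋆ 3) x₂ x₁ x₀ (d / ρ ↑) ∶ Q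
    j⊢ = conv-∶ (trans (sym (L./-⊙ Q)) (trans (cong (Q /_) (trans (↑⋆3-⊙-∷ ρ x₂ x₁ x₀ id)
             (cong (λ σ → x₀ ∷ x₁ ∷ x₂ ∷ σ) L.⊙-id))) (L.id-vanishes Q)))
           (idrec A³⊢ Q³⊢ (conv-∶ (cong (λ B → Id B x₂ x₁) (/-wk³ A)) (var (ctx-Id A⊢) zero)) d³⊢)
    w₁ = type-ctx A⊢ ▹ A⊢
    wkA⊢ = /-type w₁ (⊢*-wk (type-ctx A⊢) A⊢) A⊢
    Q¹⊢ = Ty./-motive A⊢ Q⊢ (w₁ , ⊢*-wk (type-ctx A⊢) A⊢)
    d¹⊢ = conv-∶ (/-[refl] Q A wk) (/-term (w₁ ▹ wkA⊢) (sub-↑ w₁ (⊢*-wk (type-ctx A⊢) A⊢) wkA⊢) d⊢)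
    A≡ : A / ρ / reflexivity A ≡ A / wk
    A≡ = trans (sym (L./-⊙ A)) (cong (A /_) (wk³-⊙-∷ {a = x₀} {x₀} {rfl (weaken A) x₀} {wk}))
    wk≡ : ρ ⊙ reflexivity A ≡ wk
    wk≡ = wk³-⊙-∷ {a = x₀} {x₀} {rfl (weaken A) x₀} {wk}
    Q≡ : Q / ρ ↑⋆ 3 / reflexivity A ↑⋆ 3 ≡ Q / wk ↑⋆ 3
    Q≡ = trans (/-↑⋆-⊙ 3 Q) (cong (λ σ → Q / σ ↑⋆ 3) wk≡)
    d≡ : d / ρ ↑ / reflexivity A ↑ ≡ d / wk ↑
    d≡ = trans (/-↑⋆-⊙ 1 d) (cong (λ σ → d / σ ↑) wk≡)
    T≡ : (Q / wk ↑⋆ 3) [ x₀ , x₀ , rfl (A / wk) x₀ ] ≡ Q / reflexivity A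
    T≡ = trans (sym (L./-⊙ Q)) (cong (Q /_) (trans (↑⋆3-⊙-∷ wk x₀ x₀ (rfl (A / wk) x₀) id)
           (cong₂ (λ B σ → rfl B x₀ ∷ x₀ ∷ x₀ ∷ σ) (L./-wk {t = A}) L.⊙-id)))
    -- The type annotation of `rfl` is an argument of its own: restriction along `reflexivity A`
    -- leaves `weaken A` there, but `A³ / reflexivity A` in the eliminator.
    E : (B : Exp (1+ n)) (P : Exp (4 + n)) (C : Exp (1+ n)) (c : Exp (2 + n)) → Exp (1+ n)
    E B P C c = idrec B P x₀ x₀ (rfl C x₀) c
    E≡ : E (A / wk) (Q / wk ↑⋆ 3) (A / wk) (d / wk ↑) ≡
         idrec A³ (Q / ρ ↑⋆ 3) x₂ x₁ x₀ (d / ρ ↑) / reflexivity A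
    E≡ = trans (cong₂ (λ B C → E B (Q / wk ↑⋆ 3) C (d / wk ↑)) (sym A≡) (L./-wk {t = A}))
               (cong₂ (λ P c → E (A³ / reflexivity A) P (weaken A) c) (sym Q≡) (sym d≡))
    e = idconv (A / wk) (Q / wk ↑⋆ 3) x₀ (d / wk ↑)
    e⊢ : Γ ▹ A ⊢ e ∶ Id (Q / reflexivity A) (idrec A³ (Q / ρ ↑⋆ 3) x₂ x₁ x₀ (d / ρ ↑) / reflexivity A) d
    e⊢ = conv-∶ (trans (cong₂ (λ B u → Id B u (d / wk ↑ / sub x₀)) T≡ E≡)
                  (cong (Id _ _) (trans (/-wk↑-∷ d) (L.id-vanishes d))))
           (idconv wkA⊢ Q¹⊢ (conv-∶ (sym (L./-wk {t = A})) (var₀ A⊢)) d¹⊢)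

  -- Stability of weak equivalences under pullback along display maps.

  weaken-Π : ∀ (A : Exp n) B → weaken (Π A B) ≡ Π (weaken A) (B / wk ↑)
  weaken-Π A B = trans (sym (L./-wk {t = Π A B})) (cong (λ A′ → Π A′ (B / wk ↑)) (L./-wk {t = A}))

  weaken-lam : ∀ (A : Exp n) B t → weaken (lam A B t) ≡ lam (weaken A) (B / wk ↑) (t / wk ↑)
  weaken-lam A B t = trans (sym (L./-wk {t = lam A B t})) (cong (λ A′ → lam A′ (B / wk ↑) (t / wk ↑)) (L./-wk {t = A}))

  weakenᵖ : ∀ {A B a b} → Γ ⊢ B type → Path Γ A a b → Path (Γ ▹ B) (weaken A) (weaken a) (weaken b)
  weakenᵖ B⊢ (p , p⊢) = _ , weaken-term (term-ctx p⊢) B⊢ p⊢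

  -- Congruence for evaluation at `a`, regarded as a term in a variable of type `Π A B`.
  appᵖ : ∀ {A B f g a} → Path Γ (Π A B) f g → Γ ⊢ a ∶ A →
         Path Γ (B / sub a) (app A B f a) (app A B g a)
  appᵖ {A = A} {B} {f} {g} {a} (p , p⊢) a⊢ with Id ΠAB@(Π A⊢ B⊢) _ _ ← term-type p⊢ =
    convᵖ refl (eq f) (eq g) (congᵖ (conv-∶ T≡ (app (conv-∶ (weaken-Π A B) (var₀ ΠAB)) (weaken-term w ΠAB a⊢))) (p , p⊢))
    where
    w = term-ctx p⊢
    T≡ : B / wk ↑ / sub (weaken a) ≡ weaken (B / sub a)
    T≡ = trans (/-↑-sub B wk) (trans (refl) (/-map-weaken B (sub a)))
    eq : ∀ h → app (weaken A) (B / wk ↑) x₀ (weaken a) / sub h ≡ app A B h a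
    eq h = trans (cong₂ (λ A′ B′ → app A′ B′ h (weaken a / sub h)) (L.weaken-sub A)
             (trans (/-↑⋆-⊙ 1 B) (trans (cong (λ σ → B / σ ↑) (L.wk-⊙-sub {t = h})) (L.id-vanishes B))))
           (cong (app A B h) (L.weaken-sub a))

  -- To lift `d` over the extended context, its abstraction is lifted along `f` against `Π A R` and
  -- the result is applied to the new variable. The path of functions is evaluated at that variable,
  -- and `betaconv` leads from there to `d`.
  weq-↑ : ∀ {f : Sub Exp n m} {A} → WeakEq Δ f Γ → Γ ⊢ A type → WeakEq (Δ ▹ A / f) (f ↑) (Γ ▹ A)
  weq-↑ f A⊢ .dom = dom f ▹ /-type (dom f) (typed f) A⊢
  weq-↑ f A⊢ .cod = cod f ▹ A⊢
  weq-↑ f A⊢ .typed = sub-↑ (dom f) (typed f) (/-type (dom f) (typed f) A⊢)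
  weq-↑ {Δ = Δ} {f = f₀} {A} f A⊢ .lift R {d} R⊢ d⊢ =
    let j , j⊢ , p = lift f (Π A R) (Π A⊢ R⊢) (lam A′⊢ d⊢)
        J⊢ : _ ⊢ app (weaken A) (R / wk ↑) (weaken j) x₀ ∶ R
        J⊢ = conv-∶ (trans (/-↑-sub R wk) (L.id-vanishes R))
               (app (conv-∶ (weaken-Π A R) (weaken-term (cod f) A⊢ j⊢)) (var₀ A⊢))
        P : Path (Δ ▹ A′) (Π (weaken A′) (R′ / wk ↑)) (weaken (j / f₀)) (lam (weaken A′) (R′ / wk ↑) (d / wk ↑))
        P = convᵖ (weaken-Π A′ R′) refl (weaken-lam A′ R′ d) (weakenᵖ A′⊢ p)
        q : Path (Δ ▹ A′) (R′ / wk ↑ / sub x₀)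
              (app (weaken A′) (R′ / wk ↑) (weaken (j / f₀)) x₀)
              (app (weaken A′) (R′ / wk ↑) (lam (weaken A′) (R′ / wk ↑) (d / wk ↑)) x₀)
        q = appᵖ P (var₀ A′⊢)
        β : Path (Δ ▹ A′) (R′ / wk ↑ / sub x₀)
              (app (weaken A′) (R′ / wk ↑) (lam (weaken A′) (R′ / wk ↑) (d / wk ↑)) x₀) (d / wk ↑ / sub x₀)
        β = _ , betaconv A″⊢ (var₀ A′⊢)
              (/-term (w₁ ▹ A″⊢) (subst (λ B → Δ ▹ A′ ▹ B ⊢* wk ↑ ∶ Δ ▹ A′) (L./-wk {t = A′})
                 (sub-↑ {A = A′} w₁ (⊢*-wk (dom f) A′⊢) (conv-type (sym (L./-wk {t = A′})) A″⊢))) d⊢)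
        J≡ : app (weaken A′) (R′ / wk ↑) (weaken (j / f₀)) x₀ ≡ app (weaken A) (R / wk ↑) (weaken j) x₀ / f₀ ↑
        J≡ = trans (cong₂ (λ B C → app B C (weaken (j / f₀)) x₀) (sym (weaken-/-↑ A f₀)) wk↑≡)
               (cong (λ u → app (weaken A / f₀ ↑) (R / wk ↑ / f₀ ↑ ↑) u x₀) (sym (weaken-/-↑ j f₀)))
    in _ , J⊢ , convᵖ (trans (/-↑-sub R′ wk) (L.id-vanishes R′)) J≡ (trans (/-↑-sub d wk) (L.id-vanishes d))
                  (transᵖ q β)
    where
    A′ = A / f₀
    R′ = R / f₀ ↑
    A′⊢ = /-type (dom f) (typed f) A⊢
    A″⊢ = weaken-type A′⊢ A′⊢
    w₁ = dom f ▹ A′⊢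
    wk↑≡ : R′ / wk ↑ ≡ R / wk ↑ / f₀ ↑ ↑
    wk↑≡ = trans (/-↑⋆-⊙ 1 R) (trans (cong (λ σ → R / σ ↑) L.⊙-wk) (sym (/-↑⋆-⊙ 1 R)))

  -- Transport between types that agree along a weak equivalence.

  term-∷ : ∀ {σ : Sub Exp n m} {A} B {t u} → Δ ⊢* σ ∶ Γ → Γ ▹ A ⊢ t ∶ weaken B → Δ ⊢ u ∶ A / σ →
           Δ ⊢ t / (u ∷ σ) ∶ B / σ
  term-∷ B s t⊢ u⊢ = conv-∶ (L.weaken-∷ B) (/-term (term-ctx u⊢) (u⊢ ∷ s) t⊢)

  -- Exhibits `A` as a retract of `B` up to paths, by open terms that can be substituted into.
  record Transporter (Γ : Ctx n) (A B : Exp n) : Set where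
    field
      fwd bwd  : Exp (1+ n)
      fwd⊢     : Γ ▹ A ⊢ fwd ∶ weaken B
      bwd⊢     : Γ ▹ B ⊢ bwd ∶ weaken A
      bwd∘fwd  : Path (Γ ▹ A) (weaken A) (bwd / (fwd ∷ wk)) x₀

    bwd∘fwd-/ : ∀ {σ : Sub Exp n m} {u} → Δ ⊢* σ ∶ Γ → Δ ⊢ u ∶ A / σ →
                Path Δ (A / σ) (bwd / (fwd / (u ∷ σ) ∷ σ)) u
    bwd∘fwd-/ {σ = σ} {u} s u⊢ =
      convᵖ (L.weaken-∷ A) (trans (sym (L./-⊙ bwd)) (cong (λ τ → bwd / (fwd / (u ∷ σ) ∷ τ)) wk-⊙-∷)) refl
        (/ᵖ (term-ctx u⊢) (u⊢ ∷ s) bwd∘fwd)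

  -- Over `Δ` the two types are the same expression, so the last variable serves as a map in either
  -- direction. Both maps are lifted along `f ↑`. Their composite restricts to a term joined to the
  -- variable by a path, and this path is lifted along `f ↑` in turn, against an identity type.
  transporter : ∀ {f : Sub Exp n m} {A B} → WeakEq Δ f Γ → Γ ⊢ A type → Γ ⊢ B type →
                A / f ≡ B / f → Transporter Γ A B
  transporter {Δ = Δ} {Γ = Γ} {f = f₀} {A} {B} f A⊢ B⊢ eq =
    record { fwd = T ; bwd = T′ ; fwd⊢ = T⊢ ; bwd⊢ = T′⊢ ; bwd∘fwd = proj₁ h , proj₁ (proj₂ h) }
    where
    one-way : ∀ {A B} → Γ ⊢ A type → Γ ⊢ B type → A / f₀ ≡ B / f₀ →
              ∃[ t ] Γ ▹ A ⊢ t ∶ weaken B × Path (Δ ▹ A / f₀) (weaken (B / f₀)) (t / f₀ ↑) x₀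
    one-way {A} {B} A⊢ B⊢ eq =
      let t , t⊢ , p = lift (weq-↑ f A⊢) (weaken B) (weaken-type A⊢ B⊢)
                         (conv-∶ (trans (cong weaken eq) (sym (weaken-/-↑ B f₀)))
                           (var₀ (/-type (dom f) (typed f) A⊢)))
      in t , t⊢ , convᵖ (weaken-/-↑ B f₀) refl refl p
    F = one-way A⊢ B⊢ eq
    T = proj₁ F
    T⊢ = proj₁ (proj₂ F)
    G = one-way B⊢ A⊢ (sym eq)
    T′ = proj₁ G
    T′⊢ = proj₁ (proj₂ G)
    A′⊢ = /-type (dom f) (typed f) A⊢
    w₁ : ⊢ Δ ▹ A / f₀ ctx
    w₁ = dom f ▹ A′⊢
    s₁ : Δ ▹ A / f₀ ⊢* map weaken f₀ ∶ Γ
    s₁ = sub-wk (dom f) (typed f) A′⊢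
    TT′ : Path (Δ ▹ A / f₀) (A / map weaken f₀) (T′ / (T / f₀ ↑ ∷ map weaken f₀)) (T′ / f₀ ↑)
    TT′ = congᵖ-∷ A s₁ T′⊢ (convᵖ (sym (/-map-weaken B f₀)) refl refl (proj₂ (proj₂ F)))
    T′x : Path (Δ ▹ A / f₀) (A / map weaken f₀) (T′ / f₀ ↑) x₀
    T′x = convᵖ (sym (/-map-weaken A f₀)) refl refl
            (subst (λ C → Path (Δ ▹ C) (weaken (A / f₀)) (T′ / f₀ ↑) x₀) (sym eq) (proj₂ (proj₂ G)))
    T′T⊢ : Γ ▹ A ⊢ T′ / (T ∷ wk) ∶ weaken A
    T′T⊢ = conv-∶ (L./-wk {t = A})
             (term-∷ A (⊢*-wk (cod f) A⊢) T′⊢ (conv-∶ (sym (L./-wk {t = B})) T⊢))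
    I⊢ : Γ ▹ A ⊢ Id (weaken A) (T′ / (T ∷ wk)) x₀ type
    I⊢ = Id (weaken-type A⊢ A⊢) T′T⊢ (var₀ A⊢)
    P : Path (Δ ▹ A / f₀) (A / map weaken f₀) (T′ / (T / f₀ ↑ ∷ map weaken f₀)) x₀
    P = transᵖ TT′ T′x
    I≡ : Id (A / map weaken f₀) (T′ / (T / f₀ ↑ ∷ map weaken f₀)) x₀ ≡ Id (weaken A) (T′ / (T ∷ wk)) x₀ / f₀ ↑
    I≡ = cong₂ (λ C u → Id C u x₀) (trans (/-map-weaken A f₀) (sym (weaken-/-↑ A f₀)))
           (trans (cong (λ σ → T′ / (T / f₀ ↑ ∷ σ)) (sym wk-⊙-∷)) (L./-⊙ T′))
    h = lift (weq-↑ f A⊢) _ I⊢ (conv-∶ I≡ (proj₂ P))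

  open Transporter

  -- R and its reindexing along k ⊙ π agree over k, so they can be transported into each other.
  -- A term over u thus becomes a term of R restricted along k over Δ, which π reindexes to all of Γ.
  weq-section : ∀ {k u : Sub Exp n m} {π} → WeakEq Δ k Γ → Γ ⊢* π ∶ Δ → Δ ⊢* u ∶ Γ →
                π ⊙ k ≡ id → π ⊙ u ≡ id → WeakEq Δ u Γ
  weq-section k π u πk πu .dom = dom k
  weq-section k π u πk πu .cod = cod k
  weq-section k π u πk πu .typed = u
  weq-section {k = k₀} {u₀} {π₀} k π u πk πu .lift R {d} R⊢ d⊢ =
    bwd T / (e ∷ id) , conv-∶ (L.id-vanishes R) (term-∷ R (⊢*-id (cod k)) (bwd⊢ T) (conv-∶ e≡ (/-term (cod k) π e⊢))) ,
    convᵖ refl J≡ refl (bwd∘fwd-/ T u d⊢)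
    where
    kπ = ⊢*-⊙ (cod k) (typed k) π
    R₀ = R / (k₀ ⊙ π₀)
    kπk : k₀ ⊙ π₀ ⊙ k₀ ≡ k₀
    kπk = trans (sym L.⊙-assoc) (trans (cong (k₀ ⊙_) πk) L.⊙-id)
    kπu : k₀ ⊙ π₀ ⊙ u₀ ≡ k₀
    kπu = trans (sym L.⊙-assoc) (trans (cong (k₀ ⊙_) πu) L.⊙-id)
    T : Transporter _ R R₀
    T = transporter k R⊢ (/-type (cod k) kπ R⊢) (sym (trans (sym (L./-⊙ R)) (cong (R /_) kπk)))
    e⊢ : _ ⊢ fwd T / (d ∷ u₀) ∶ R / k₀
    e⊢ = conv-∶ (trans (sym (L./-⊙ R)) (cong (R /_) kπu)) (term-∷ R₀ u (fwd⊢ T) d⊢)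
    e = fwd T / (d ∷ u₀) / π₀
    e≡ : R / k₀ / π₀ ≡ R₀ / id
    e≡ = trans (sym (L./-⊙ R)) (sym (L.id-vanishes R₀))
    J≡ : bwd T / (fwd T / (d ∷ u₀) ∷ u₀) ≡ bwd T / (e ∷ id) / u₀
    J≡ = trans (cong₂ (λ v τ → bwd T / (v ∷ τ))
           (sym (trans (sym (L./-⊙ (fwd T / (d ∷ u₀)))) (trans (cong (fwd T / (d ∷ u₀) /_) πu) (L.id-vanishes _))))
           (sym L.id-⊙)) (L./-⊙ (bwd T))

  -- Transport along paths in families, and composition of paths.

  wk²-⊙-∷ : ∀ a b {σ : Sub Exp n m} → wk² ⊙ (b ∷ a ∷ σ) ≡ σ
  wk²-⊙-∷ a b = trans (map-weaken-⊙-∷ wk b _) wk-⊙-∷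

  wk⁵-⊙-∷ : ∀ a b c d e {σ : Sub Exp n m} → wk⁵ ⊙ (e ∷ d ∷ c ∷ b ∷ a ∷ σ) ≡ σ
  wk⁵-⊙-∷ a b c d e = trans (map-weaken-⊙-∷ wk⁴ e _) (trans (map-weaken-⊙-∷ wk³ d _)
                        (wk³-⊙-∷ {a = a} {b} {c}))

  -- Congruence in the last variable but one. The term `u` can stay fixed because its type does not
  -- depend on that variable.
  congᵖ-∷₂ : ∀ {σ : Sub Exp n m} {A B} C {a b t u} → Δ ⊢* σ ∶ Γ → Γ ⊢ B type → Γ ▹ A ▹ weaken B ⊢ t ∶ weaken (weaken C) →
             Path Δ (A / σ) a b → Δ ⊢ u ∶ B / σ → Path Δ (C / σ) (t / (u ∷ a ∷ σ)) (t / (u ∷ b ∷ σ))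
  congᵖ-∷₂ {σ = σ} {A} {B} C {t = t} {u} s B⊢ t⊢ (p , p⊢) u⊢ with Id A⊢ _ _ ← term-type p⊢ =
    convᵖ refl (eq _) (eq _) (congᵖ
      (conv-∶ (trans (weaken²-∷ C) (/-map-weaken C σ))
        (/-term (w ▹ A⊢) (u⊢′ ∷ sub-↑ w s A⊢) t⊢)) (p , p⊢))
    where
    w = term-ctx p⊢
    u⊢′ = conv-∶ (sym (trans (L.weaken-∷ B) (/-map-weaken B σ))) (weaken-term w A⊢ u⊢)
    eq : ∀ c → t / (weaken u ∷ x₀ ∷ map weaken σ) / sub c ≡ t / (u ∷ c ∷ σ)
    eq c = trans (sym (L./-⊙ t)) (cong₂ (λ v τ → t / (v ∷ c ∷ τ)) (L.weaken-sub u)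
             (trans (map-weaken-⊙-∷ σ c id) L.⊙-id))

  -- Transport with an inverse law. `R₁` and `R₂` are `R` at the two endpoints of the generic path;
  -- they agree along reflexivity, so `transporter` applies to them.
  module PathTransport {Γ : Ctx n} {B R} (B⊢ : Γ ⊢ B type) (R⊢ : Γ ▹ B ⊢ R type) where

    private
      R₁ R₂ : Exp (2 + n)
      R₁ = weaken R
      R₂ = R / (x₀ ∷ wk²)

      w₁ : ⊢ Γ ▹ B ctx
      w₁ = type-ctx B⊢ ▹ B⊢
      B₁⊢ : Γ ▹ B ⊢ weaken B type
      B₁⊢ = weaken-type B⊢ B⊢
      w₂ : ⊢ Γ ▹ B ▹ weaken B ctx
      w₂ = w₁ ▹ B₁⊢
      wk²⊢ : Γ ▹ B ▹ weaken B ⊢* wk² ∶ Γ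
      wk²⊢ = sub-wk w₁ (⊢*-wk (type-ctx B⊢) B⊢) B₁⊢
      I⊢ : Γ ▹ B ▹ weaken B ⊢ Id (weaken (weaken B)) x₁ x₀ type
      I⊢ with ctx-Id B⊢
      ... | _ ▹ I = I
      R₁⊢ : Γ ▹ B ▹ weaken B ⊢ R₁ type
      R₁⊢ = weaken-type B₁⊢ R⊢
      R₂⊢ : Γ ▹ B ▹ weaken B ⊢ R₂ type
      R₂⊢ = /-type w₂ (conv-∶ (sym (trans (/-map-weaken B wk) (cong weaken (L./-wk {t = B})))) (var w₂ zero) ∷ wk²⊢) R⊢

      R₁≡ : ∀ {v v′ : Exp m} {σ} → R₁ / (v′ ∷ v ∷ σ) ≡ R / (v ∷ σ)
      R₁≡ = L.weaken-∷ R
      R₂≡ : ∀ {v v′ : Exp m} {σ} → R₂ / (v′ ∷ v ∷ σ) ≡ R / (v′ ∷ σ)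
      R₂≡ {v = v} {v′} = trans (sym (L./-⊙ R)) (cong (λ τ → R / (v′ ∷ τ)) (wk²-⊙-∷ v v′))

      abstract
        -- The direction is from the second endpoint to the first: the forward map is `back`, and
        -- the retraction law becomes `forth∘back`.
        T : Transporter (Γ ▹Id B) (weaken R₂) (weaken R₁)
        T = transporter (weq-reflexivity B⊢) (weaken-type I⊢ R₂⊢) (weaken-type I⊢ R₁⊢)
              (trans (L.weaken-∷ R₂) (trans R₂≡ (trans (sym R₁≡) (sym (L.weaken-∷ R₁)))))

    back forth : Exp (4 + n)
    back  = Transporter.fwd T
    forth = Transporter.bwd T

    module _ {σ : Sub Exp n m} {v v′} (s : Δ ⊢* σ ∶ Γ) (v⊢ : Δ ⊢ v ∶ B / σ) (v′⊢ : Δ ⊢ v′ ∶ B / σ) where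
      private
        s₂ : Δ ⊢* v′ ∷ v ∷ σ ∶ Γ ▹ B ▹ weaken B
        s₂ = conv-∶ (sym (L.weaken-∷ B)) v′⊢ ∷ v⊢ ∷ s

      back⊢ : ∀ {p w} → Δ ⊢ p ∶ Id (B / σ) v v′ → Δ ⊢ w ∶ R / (v′ ∷ σ) → Δ ⊢ back / (w ∷ p ∷ v′ ∷ v ∷ σ) ∶ R / (v ∷ σ)
      back⊢ p⊢ w⊢ = conv-∶ (trans (L.weaken-∷ R₁) R₁≡)
        (term-∷ (weaken R₁) (⊢*-Id s v⊢ v′⊢ p⊢) (Transporter.fwd⊢ T)
          (conv-∶ (sym (trans (L.weaken-∷ R₂) R₂≡)) w⊢))

      forth⊢ : ∀ {p w} → Δ ⊢ p ∶ Id (B / σ) v v′ → Δ ⊢ w ∶ R / (v ∷ σ) → Δ ⊢ forth / (w ∷ p ∷ v′ ∷ v ∷ σ) ∶ R / (v′ ∷ σ)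
      forth⊢ p⊢ w⊢ = conv-∶ (trans (L.weaken-∷ R₂) R₂≡)
        (term-∷ (weaken R₂) (⊢*-Id s v⊢ v′⊢ p⊢) (Transporter.bwd⊢ T)
          (conv-∶ (sym (trans (L.weaken-∷ R₁) R₁≡)) w⊢))

      forth∘back : ∀ {p w} → Δ ⊢ p ∶ Id (B / σ) v v′ → Δ ⊢ w ∶ R / (v′ ∷ σ) →
                   Path Δ (R / (v′ ∷ σ)) (forth / (back / (w ∷ p ∷ v′ ∷ v ∷ σ) ∷ p ∷ v′ ∷ v ∷ σ)) w
      forth∘back p⊢ w⊢ = convᵖ (trans (L.weaken-∷ R₂) R₂≡) refl refl
        (Transporter.bwd∘fwd-/ T (⊢*-Id s v⊢ v′⊢ p⊢) (conv-∶ (sym (trans (L.weaken-∷ R₂) R₂≡)) w⊢))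

      forth-cong₁ : ∀ {p w w′} → Δ ⊢ p ∶ Id (B / σ) v v′ → Path Δ (R / (v ∷ σ)) w w′ →
                    Path Δ (R / (v′ ∷ σ)) (forth / (w ∷ p ∷ v′ ∷ v ∷ σ)) (forth / (w′ ∷ p ∷ v′ ∷ v ∷ σ))
      forth-cong₁ p⊢ q = convᵖ (trans (L.weaken-∷ R₂) R₂≡) refl refl
        (congᵖ-∷ (weaken R₂) (⊢*-Id s v⊢ v′⊢ p⊢) (Transporter.bwd⊢ T)
          (convᵖ (sym (trans (L.weaken-∷ R₁) R₁≡)) refl refl q))

      forth-cong₂ : ∀ {p p′ w} → Path Δ (Id (B / σ) v v′) p p′ → Δ ⊢ w ∶ R / (v ∷ σ) →
                    Path Δ (R / (v′ ∷ σ)) (forth / (w ∷ p ∷ v′ ∷ v ∷ σ)) (forth / (w ∷ p′ ∷ v′ ∷ v ∷ σ))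
      forth-cong₂ q w⊢ = convᵖ R₂≡ refl refl
        (congᵖ-∷₂ R₂ s₂ R₁⊢ (Transporter.bwd⊢ T)
          (convᵖ (cong (λ C → Id C _ _) (sym (weaken²-∷ B))) refl refl q) (conv-∶ (sym R₁≡) w⊢))

  -- c / (v ∷ u ∷ y ∷ x ∷ z ∷ σ) is the composite v · u of v : z = x and u : x = y, with unit : v · refl = v
  -- and left-unit : refl · u = u.

  module Composition {Γ : Ctx n} {A} (A⊢ : Γ ⊢ A type) where

    private
      A₁ = weaken A
      A₁⊢ = weaken-type A⊢ A⊢
      A⁴ = weaken (weaken (weaken A₁))
      V : Exp (4 + n)
      V = Id A⁴ x₃ x₂
      C : Exp (5 + n)
      C = Id (weaken A⁴) x₄ x₂

      w⁴ : ⊢ (Γ ▹ A) ▹Id A₁ ctx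
      w⁴ = ctx-Id A₁⊢
      A⁴⊢ : (Γ ▹ A) ▹Id A₁ ⊢ A⁴ type
      A⁴⊢ = lookup-type w⁴ (suc (suc (suc zero)))
      V⊢ : (Γ ▹ A) ▹Id A₁ ⊢ V type
      V⊢ = Id A⁴⊢ (var w⁴ (suc (suc (suc zero)))) (var w⁴ (suc (suc zero)))
      w⁵ : ⊢ (Γ ▹ A) ▹Id A₁ ▹ V ctx
      w⁵ = w⁴ ▹ V⊢
      C⊢ : (Γ ▹ A) ▹Id A₁ ▹ V ⊢ C type
      C⊢ = Id (weaken-type V⊢ A⁴⊢) (var w⁵ (suc (suc (suc (suc zero))))) (var w⁵ (suc (suc zero)))

      ρ = reflexivity A₁
      V′⊢ = /-type (dom (weq-reflexivity A₁⊢)) (typed (weq-reflexivity A₁⊢)) V⊢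

      abstract
        composition : ∃[ j ] (Γ ▹ A) ▹Id A₁ ▹ V ⊢ j ∶ C × Path (Γ ▹ A ▹ A₁ ▹ V / ρ) (C / ρ ↑) (j / ρ ↑) x₀
        -- This is induction on `u` with `v` as a parameter, which `weq-↑` provides. Along
        -- reflexivity the types of `v` and of the composite coincide, so `v` itself is lifted, and
        -- the path that comes with the lift is the law `unit`.
        composition = lift (weq-↑ (weq-reflexivity A₁⊢) V⊢) C C⊢
          (conv-∶ (cong (λ B → Id B x₂ x₁) (sym (weaken-/-↑ A⁴ ρ))) (var₀ V′⊢))

      A⁴≡ : ∀ {z x y u : Exp m} {σ} → A⁴ / (u ∷ y ∷ x ∷ z ∷ σ) ≡ A / σ
      A⁴≡ = trans (weaken²-∷ (weaken A₁)) (weaken²-∷ A)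

    c : Exp (5 + n)
    c = proj₁ composition

    unit : Exp (3 + n)
    unit = proj₁ (proj₂ (proj₂ composition))

    module _ {σ : Sub Exp n m} {z x} (s : Δ ⊢* σ ∶ Γ) (z⊢ : Δ ⊢ z ∶ A / σ) (x⊢ : Δ ⊢ x ∶ A / σ) where

      c⊢ : ∀ {y u v} → Δ ⊢ y ∶ A / σ → Δ ⊢ u ∶ Id (A / σ) x y → Δ ⊢ v ∶ Id (A / σ) z x →
           Δ ⊢ c / (v ∷ u ∷ y ∷ x ∷ z ∷ σ) ∶ Id (A / σ) z y
      c⊢ {y} {u} {v} y⊢ u⊢ v⊢ = conv-∶ (cong (λ B → Id B z y) (trans (L.weaken-∷ A⁴) A⁴≡))
        (/-term (term-ctx z⊢) (conv-∶ (cong (λ B → Id B z x) (sym A⁴≡)) v⊢ ∷ s⁴) (proj₁ (proj₂ composition)))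
        where
        A₁≡ = sym (L.weaken-∷ A)
        s⁴ : Δ ⊢* u ∷ y ∷ x ∷ z ∷ σ ∶ (Γ ▹ A) ▹Id A₁
        s⁴ = ⊢*-Id (z⊢ ∷ s) (conv-∶ A₁≡ x⊢) (conv-∶ A₁≡ y⊢) (conv-∶ (cong (λ B → Id B x y) A₁≡) u⊢)

      unit⊢ : ∀ {v} → Δ ⊢ v ∶ Id (A / σ) z x →
              Δ ⊢ unit / (v ∷ x ∷ z ∷ σ) ∶ Id (Id (A / σ) z x) (c / (v ∷ rfl (A / σ) x ∷ x ∷ x ∷ z ∷ σ)) v
      unit⊢ {v} v⊢ = conv-∶
        (cong₂ (λ B u → Id (Id B z x) u v) A≡ c≡)
        (/-term (term-ctx z⊢) s³ (proj₂ (proj₂ (proj₂ composition))))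
        where
        ρ≡ : ρ ⊙ (x ∷ z ∷ σ) ≡ rfl (A / σ) x ∷ x ∷ x ∷ z ∷ σ
        ρ≡ = cong₂ (λ B τ → rfl B x ∷ x ∷ x ∷ τ) (weaken²-∷ A) wk-⊙-∷
        A≡′ : A⁴ / ρ / (x ∷ z ∷ σ) ≡ A / σ
        A≡′ = trans (sym (L./-⊙ A⁴)) (trans (cong (A⁴ /_) ρ≡) A⁴≡)
        A≡ : weaken A⁴ / ρ ↑ / (v ∷ x ∷ z ∷ σ) ≡ A / σ
        A≡ = trans (cong (_/ _) (weaken-/-↑ A⁴ ρ)) (trans (L.weaken-∷ (A⁴ / ρ)) A≡′)
        c≡ : c / ρ ↑ / (v ∷ x ∷ z ∷ σ) ≡ c / (v ∷ rfl (A / σ) x ∷ x ∷ x ∷ z ∷ σ)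
        c≡ = trans (/-↑-∷ c ρ) (cong (λ τ → c / (v ∷ τ)) ρ≡)
        s³ : Δ ⊢* v ∷ x ∷ z ∷ σ ∶ Γ ▹ A ▹ A₁ ▹ V / ρ
        s³ = conv-∶ (cong (λ B → Id B z x) (sym A≡′)) v⊢ ∷ conv-∶ (sym (L.weaken-∷ A)) x⊢ ∷ z⊢ ∷ s

    private
      A³ = A / wk³
      u⊢ : Γ ▹Id A ⊢ x₀ ∶ Id A³ x₂ x₁
      u⊢ = conv-∶ (cong (λ B → Id B x₂ x₁) (/-wk³ A)) (var (ctx-Id A⊢) zero)
      x₂⊢ : Γ ▹Id A ⊢ x₂ ∶ A³
      x₂⊢ = conv-∶ (/-wk³ A) (var (ctx-Id A⊢) (suc (suc zero)))
      x₁⊢ : Γ ▹Id A ⊢ x₁ ∶ A³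
      x₁⊢ = conv-∶ (/-wk³ A) (var (ctx-Id A⊢) (suc zero))

      M : Exp (3 + n)
      M = Id (Id A³ x₂ x₁) (c / (rfl A³ x₂ ∷ x₀ ∷ x₁ ∷ x₂ ∷ x₂ ∷ wk³)) x₀
      M⊢ : Γ ▹Id A ⊢ M type
      M⊢ = Id (term-type u⊢) (c⊢ (⊢*-wk³ A⊢) x₂⊢ x₂⊢ x₁⊢ u⊢ (rfl x₂⊢)) u⊢

      M≡ : ∀ {x y u : Exp m} {σ} → M / (u ∷ y ∷ x ∷ σ) ≡ Id (Id (A / σ) x y) (c / (rfl (A / σ) x ∷ u ∷ y ∷ x ∷ x ∷ σ)) u
      M≡ {x = x} {y} {u} {σ} = trans
        (cong (λ t → Id (Id (A³ / τ) x y) t u) (trans (sym (L./-⊙ c))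
          (cong (λ υ → c / (rfl (A³ / τ) x ∷ u ∷ y ∷ x ∷ x ∷ υ)) wk≡)))
        (cong (λ B → Id (Id B x y) (c / (rfl B x ∷ u ∷ y ∷ x ∷ x ∷ σ)) u)
          (trans (sym (L./-⊙ A)) (cong (A /_) wk≡)))
        where
        τ = u ∷ y ∷ x ∷ σ
        wk≡ : wk³ ⊙ τ ≡ σ
        wk≡ = wk³-⊙-∷ {a = x} {y} {u}

      x₀⊢ : Γ ▹ A ⊢ x₀ ∶ A / wk
      x₀⊢ = conv-∶ (sym (L./-wk {t = A})) (var₀ A⊢)

      -- The computation rule makes left-unit and unit agree on refl · refl, which based induction needs.
      abstract
        left : ∃[ j ] Γ ▹Id A ⊢ j ∶ M ×
               Path (Γ ▹ A) (M / reflexivity A) (j / reflexivity A) (unit / (rfl (A / wk) x₀ ∷ x₀ ∷ x₀ ∷ wk))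
        left = lift (weq-reflexivity A⊢) M M⊢ (conv-∶
          (trans (cong (λ B → Id (Id (A / wk) x₀ x₀) (c / (rfl (A / wk) x₀ ∷ rfl B x₀ ∷ x₀ ∷ x₀ ∷ x₀ ∷ wk)) (rfl B x₀))
                   (L./-wk {t = A})) (sym M≡))
          (unit⊢ (⊢*-wk (type-ctx A⊢) A⊢) x₀⊢ x₀⊢ (rfl x₀⊢)))

    left-unit : Exp (3 + n)
    left-unit = proj₁ left

    left-unit⊢ : ∀ {σ : Sub Exp n m} {x y u} → Δ ⊢* σ ∶ Γ → Δ ⊢ x ∶ A / σ → Δ ⊢ y ∶ A / σ → Δ ⊢ u ∶ Id (A / σ) x y →
                 Δ ⊢ left-unit / (u ∷ y ∷ x ∷ σ) ∶ Id (Id (A / σ) x y) (c / (rfl (A / σ) x ∷ u ∷ y ∷ x ∷ x ∷ σ)) u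
    left-unit⊢ s x⊢ y⊢ u⊢ = conv-∶ M≡ (/-term (term-ctx x⊢) (⊢*-Id s x⊢ y⊢ u⊢) (proj₁ (proj₂ left)))

    left-unit-rfl : ∀ {σ : Sub Exp n m} {x} → Δ ⊢* σ ∶ Γ → Δ ⊢ x ∶ A / σ → let r = rfl (A / σ) x in
                    Path Δ (Id (Id (A / σ) x x) (c / (r ∷ r ∷ x ∷ x ∷ x ∷ σ)) r)
                      (left-unit / (r ∷ x ∷ x ∷ σ)) (unit / (r ∷ x ∷ x ∷ σ))
    left-unit-rfl {σ = σ} {x} s x⊢ = convᵖ
      (trans (/-[refl]-∷ M A) M≡)
      (/-[refl]-∷ left-unit A)
      (trans (sym (L./-⊙ unit)) (cong₂ (λ B τ → unit / (rfl B x ∷ x ∷ x ∷ τ))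
        (trans (cong (_/ _) (L./-wk {t = A})) (L.weaken-∷ A)) wk-⊙-∷))
      (/ᵖ (term-ctx x⊢) (x⊢ ∷ s) (proj₂ (proj₂ left)))

  -- Based path induction.

  ⊢*-head : ∀ {σ : Sub Exp n m} {A t} → Δ ⊢* t ∷ σ ∶ Γ ▹ A → Δ ⊢ t ∶ A / σ
  ⊢*-head (t ∷ _) = t

  ⊢*-tail : ∀ {σ : Sub Exp n m} {A t} → Δ ⊢* t ∷ σ ∶ Γ ▹ A → Δ ⊢* σ ∶ Γ
  ⊢*-tail (_ ∷ s) = s

  private
    cong₃ : ∀ {A B C D : Set} (f : A → B → C → D) {a a′ b b′ c c′} →
            a ≡ a′ → b ≡ b′ → c ≡ c′ → f a b c ≡ f a′ b′ c′
    cong₃ f refl refl refl = refl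

    Id-≡ : ∀ {A B a b : Exp n} → A ≡ B → Id A a b ≡ Id B a b
    Id-≡ refl = refl

  infixl 5 _▹Id⟨_,_⟩

  _▹Id⟨_,_⟩ : Ctx n → (A a : Exp n) → Ctx (2 + n)
  Γ ▹Id⟨ A , a ⟩ = Γ ▹ A ▹ Id (weaken A) (weaken a) x₀

  module BasedPathInduction {Γ : Ctx n} {A a} (a⊢ : Γ ⊢ a ∶ A) where

    private
      A⊢ = term-type a⊢
      wΓ = term-ctx a⊢

      I : Exp (1+ n)
      I = Id (weaken A) (weaken a) x₀
      I⊢ : Γ ▹ A ⊢ I type
      I⊢ = Id (weaken-type A⊢ A⊢) (weaken-term wΓ A⊢ a⊢) (var₀ A⊢)

      I≡ : ∀ {y : Exp m} {σ} → I / (y ∷ σ) ≡ Id (A / σ) (a / σ) y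
      I≡ = cong₂ (λ B b → Id B b _) (L.weaken-∷ A) (L.weaken-∷ a)

    ⊢*-based : ∀ {σ : Sub Exp n m} {y u} → Δ ⊢* σ ∶ Γ → Δ ⊢ y ∶ A / σ → Δ ⊢ u ∶ Id (A / σ) (a / σ) y →
               Δ ⊢* u ∷ y ∷ σ ∶ Γ ▹Id⟨ A , a ⟩
    ⊢*-based s y⊢ u⊢ = conv-∶ (sym I≡) u⊢ ∷ y⊢ ∷ s

    module _ {R d} (R⊢ : Γ ▹Id⟨ A , a ⟩ ⊢ R type) (d⊢ : Γ ⊢ d ∶ R / (rfl A a ∷ a ∷ id)) where

      open Composition A⊢
      open PathTransport I⊢ R⊢

      private
        -- Ordinary induction on u : x = y gives (v : a = x) → R (x , v) → R (y , v · u); at v = refl the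
        -- result is transported along refl · u = u.
        V : Exp (3 + n)
        V = Id (A / wk³) (a / wk³) x₂
        W : Exp (4 + n)
        W = R / (x₀ ∷ x₃ ∷ wk⁴)
        U : Exp (5 + n)
        U = R / (c / (x₁ ∷ x₂ ∷ x₃ ∷ x₄ ∷ a / wk⁵ ∷ wk⁵) ∷ x₃ ∷ wk⁵)

        V≡ : ∀ {x y u : Exp m} {σ} → V / (u ∷ y ∷ x ∷ σ) ≡ Id (A / σ) (a / σ) x
        V≡ {x = x} {y} {u} = cong₂ (λ B b → Id B b x)
          (trans (sym (L./-⊙ A)) (cong (A /_) (wk³-⊙-∷ {a = x} {y} {u})))
          (trans (sym (L./-⊙ a)) (cong (a /_) (wk³-⊙-∷ {a = x} {y} {u})))

        W≡ : ∀ {x y u v : Exp m} {σ} → W / (v ∷ u ∷ y ∷ x ∷ σ) ≡ R / (v ∷ x ∷ σ)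
        W≡ {x = x} {y} {u} {v} = trans (sym (L./-⊙ R)) (cong (λ τ → R / (v ∷ x ∷ τ))
          (trans (map-weaken-⊙-∷ wk³ v _) (wk³-⊙-∷ {a = x} {y} {u})))

        U≡ : ∀ {x y u v w : Exp m} {σ} → U / (w ∷ v ∷ u ∷ y ∷ x ∷ σ) ≡ R / (c / (v ∷ u ∷ y ∷ x ∷ a / σ ∷ σ) ∷ y ∷ σ)
        U≡ {x = x} {y} {u} {v} {w} {σ} = trans (sym (L./-⊙ R)) (cong₂ (λ t τ → R / (t ∷ y ∷ τ))
          (trans (sym (L./-⊙ c)) (cong₂ (λ b τ → c / (v ∷ u ∷ y ∷ x ∷ b ∷ τ)) (trans (sym (L./-⊙ a)) (cong (a /_) wk≡)) wk≡)) wk≡)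
          where
          wk≡ : wk⁵ ⊙ (w ∷ v ∷ u ∷ y ∷ x ∷ σ) ≡ σ
          wk≡ = wk⁵-⊙-∷ x y u v w

        r : Sub Exp (3 + n) (1+ n)
        r = reflexivity A

        r≡ : ∀ {x : Exp m} {σ} → r ⊙ (x ∷ σ) ≡ rfl (A / σ) x ∷ x ∷ x ∷ σ
        r≡ {x = x} {σ} = cong₂ (λ B τ → rfl B x ∷ x ∷ x ∷ τ) (L.weaken-∷ A) wk-⊙-∷

        V⊢ : Γ ▹Id A ⊢ V type
        V⊢ = Id (/-type (ctx-Id A⊢) (⊢*-wk³ A⊢) A⊢) (/-term (ctx-Id A⊢) (⊢*-wk³ A⊢) a⊢)
               (conv-∶ (/-wk³ A) (var (ctx-Id A⊢) (suc (suc zero))))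

        W⊢ : Γ ▹Id A ▹ V ⊢ W type
        W⊢ = /-type w (⊢*-based (⊢*-tail (⊢*-tail (⊢*-tail (⊢*-tail s)))) (⊢*-head (⊢*-tail (⊢*-tail (⊢*-tail s))))
               (conv-∶ V≡ (⊢*-head s))) R⊢
          where
          w : ⊢ Γ ▹Id A ▹ V ctx
          w = ctx-Id A⊢ ▹ V⊢
          s = ⊢*-id w

        U⊢ : Γ ▹Id A ▹ V ▹ W ⊢ U type
        U⊢ = /-type w (⊢*-based s y⊢ (c⊢ s (/-term w s a⊢) x⊢ y⊢ u⊢ v⊢)) R⊢
          where
          w : ⊢ Γ ▹Id A ▹ V ▹ W ctx
          w = ctx-Id A⊢ ▹ V⊢ ▹ W⊢
          s⁴ = ⊢*-tail (⊢*-id w)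
          s³ = ⊢*-tail s⁴
          s² = ⊢*-tail s³
          s¹ = ⊢*-tail s²
          s  = ⊢*-tail s¹
          v⊢ = conv-∶ V≡ (⊢*-head s⁴)
          u⊢ = conv-∶ (cong (λ B → Id B x₄ x₃) (weaken²-∷ A)) (⊢*-head s³)
          y⊢ = conv-∶ (L.weaken-∷ A) (⊢*-head s²)
          x⊢ = ⊢*-head s¹

        rV : WeakEq (Γ ▹ A ▹ V / r) (r ↑) (Γ ▹Id A ▹ V)
        rV = weq-↑ (weq-reflexivity A⊢) V⊢

        rW : WeakEq (Γ ▹ A ▹ V / r ▹ W / r ↑) (r ↑ ↑) (Γ ▹Id A ▹ V ▹ W)
        rW = weq-↑ rV W⊢

        -- At `u = refl` the goal is `R` at the composite `v · refl`. The given term of `R` at `v`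
        -- is carried back to it along `unit`.
        base-case : Exp (3 + n)
        base-case = back / (x₀ ∷ unit / (x₁ ∷ x₂ ∷ a / wk³ ∷ wk³) ∷ x₁ ∷
                      c / (x₁ ∷ rfl (A / wk³) x₂ ∷ x₂ ∷ x₂ ∷ a / wk³ ∷ wk³) ∷ x₂ ∷ wk³)

        base-case⊢ : Γ ▹ A ▹ V / r ▹ W / r ↑ ⊢ base-case ∶ U / r ↑ ↑
        base-case⊢ = conv-∶
            (trans (cong (λ B → R / (c / (x₁ ∷ rfl B x₂ ∷ x₂ ∷ x₂ ∷ a / wk³ ∷ wk³) ∷ x₂ ∷ wk³)) (sym (/-wk³ A))) (sym U≡))
            (back⊢ (x⊢ ∷ s) (conv-∶ (sym I≡) (c⊢ s a′⊢ x⊢ x⊢ (rfl x⊢) v⊢)) (conv-∶ (sym I≡) v⊢)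
              (conv-∶ (cong (λ B → Id B (c / (x₁ ∷ rfl (A / wk³) x₂ ∷ x₂ ∷ x₂ ∷ a / wk³ ∷ wk³)) x₁) (sym I≡)) (unit⊢ s a′⊢ x⊢ v⊢)) w⊢)
          where
          s³ = ⊢*-id (dom rW)
          s² = ⊢*-tail s³
          s¹ = ⊢*-tail s²
          s  = ⊢*-tail s¹
          x⊢ = ⊢*-head s¹
          a′⊢ = /-term (dom rW) s a⊢
          v⊢ = conv-∶ (trans (sym (L./-⊙ V)) (trans (cong (V /_) r≡) V≡)) (⊢*-head s²)
          w⊢ = conv-∶ (trans (/-↑-∷ W r) (trans (cong (λ τ → W / (x₁ ∷ τ)) r≡) W≡)) (⊢*-head s³)

        abstract
          based : ∃[ j ] Γ ▹Id A ▹ V ▹ W ⊢ j ∶ U ×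
                  Path (Γ ▹ A ▹ V / r ▹ W / r ↑) (U / r ↑ ↑) (j / r ↑ ↑) base-case
          based = lift rW U U⊢ base-case⊢

        J : Exp (5 + n)
        J = proj₁ based

        J⊢ : ∀ {σ : Sub Exp n m} {x y u v w} → Δ ⊢* σ ∶ Γ → Δ ⊢ x ∶ A / σ → Δ ⊢ y ∶ A / σ → Δ ⊢ u ∶ Id (A / σ) x y →
             Δ ⊢ v ∶ Id (A / σ) (a / σ) x → Δ ⊢ w ∶ R / (v ∷ x ∷ σ) →
             Δ ⊢ J / (w ∷ v ∷ u ∷ y ∷ x ∷ σ) ∶ R / (c / (v ∷ u ∷ y ∷ x ∷ a / σ ∷ σ) ∷ y ∷ σ)
        J⊢ s x⊢ y⊢ u⊢ v⊢ w⊢ = conv-∶ U≡ (/-term (term-ctx x⊢)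
          (conv-∶ (sym W≡) w⊢ ∷ conv-∶ (sym V≡) v⊢ ∷ ⊢*-Id s x⊢ y⊢ u⊢) (proj₁ (proj₂ based)))

        J-rfl : ∀ {σ : Sub Exp n m} {x v w} → Δ ⊢* σ ∶ Γ → Δ ⊢ x ∶ A / σ →
                Δ ⊢ v ∶ Id (A / σ) (a / σ) x → Δ ⊢ w ∶ R / (v ∷ x ∷ σ) →
                let ρ = rfl (A / σ) x
                    cᵣ = c / (v ∷ ρ ∷ x ∷ x ∷ a / σ ∷ σ) in
                Path Δ (R / (cᵣ ∷ x ∷ σ)) (J / (w ∷ v ∷ ρ ∷ x ∷ x ∷ σ))
                  (back / (w ∷ unit / (v ∷ x ∷ a / σ ∷ σ) ∷ v ∷ cᵣ ∷ x ∷ σ))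
        J-rfl {σ = σ} {x} {v} {w} s x⊢ v⊢ w⊢ = convᵖ
          (trans (sym (L./-⊙ U)) (trans (cong (U /_) r↑↑≡) U≡))
          (trans (sym (L./-⊙ J)) (cong (J /_) r↑↑≡))
          base≡
          (/ᵖ (term-ctx x⊢) (conv-∶ (sym (trans (/-↑-∷ W r) (trans (cong (λ τ → W / (v ∷ τ)) r≡) W≡))) w⊢ ∷
            conv-∶ (sym (trans (sym (L./-⊙ V)) (trans (cong (V /_) r≡) V≡))) v⊢ ∷ x⊢ ∷ s) (proj₂ (proj₂ based)))
          where
          τ = w ∷ v ∷ x ∷ σ
          r↑↑≡ : r ↑ ↑ ⊙ τ ≡ w ∷ v ∷ rfl (A / σ) x ∷ x ∷ x ∷ σ
          r↑↑≡ = trans (↑-⊙-∷ (r ↑)) (cong (w ∷_) (trans (↑-⊙-∷ r) (cong (v ∷_) r≡)))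
          wk≡ : wk³ ⊙ τ ≡ σ
          wk≡ = wk³-⊙-∷ {a = x} {v} {w}
          A≡ : A / wk³ / τ ≡ A / σ
          A≡ = trans (sym (L./-⊙ A)) (cong (A /_) wk≡)
          a≡ : a / wk³ / τ ≡ a / σ
          a≡ = trans (sym (L./-⊙ a)) (cong (a /_) wk≡)
          unit≡ : unit / (x₁ ∷ x₂ ∷ a / wk³ ∷ wk³) / τ ≡ unit / (v ∷ x ∷ a / σ ∷ σ)
          unit≡ = trans (sym (L./-⊙ unit)) (cong₂ (λ b υ → unit / (v ∷ x ∷ b ∷ υ)) a≡ wk≡)
          c≡ : c / (x₁ ∷ rfl (A / wk³) x₂ ∷ x₂ ∷ x₂ ∷ a / wk³ ∷ wk³) / τ ≡ c / (v ∷ rfl (A / σ) x ∷ x ∷ x ∷ a / σ ∷ σ)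
          c≡ = trans (sym (L./-⊙ c)) (trans
            (cong₂ (λ B b → c / (v ∷ rfl B x ∷ x ∷ x ∷ b ∷ wk³ ⊙ τ)) A≡ a≡)
            (cong (λ υ → c / (v ∷ rfl (A / σ) x ∷ x ∷ x ∷ a / σ ∷ υ)) wk≡))
          base≡ : base-case / τ ≡ back / (w ∷ unit / (v ∷ x ∷ a / σ ∷ σ) ∷ v ∷ c / (v ∷ rfl (A / σ) x ∷ x ∷ x ∷ a / σ ∷ σ) ∷ x ∷ σ)
          base≡ = trans (sym (L./-⊙ back)) (trans
            (cong₂ (λ e t → back / (w ∷ e ∷ v ∷ t ∷ x ∷ wk³ ⊙ τ)) unit≡ c≡)
            (cong (λ υ → back / (w ∷ _ ∷ v ∷ _ ∷ x ∷ υ)) wk≡))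

        ind : Sub Exp n m → (y u : Exp m) → Exp m
        ind σ y u = forth / (J / (d / σ ∷ r₀ ∷ u ∷ y ∷ a / σ ∷ σ) ∷ left-unit / (u ∷ y ∷ a / σ ∷ σ) ∷ u ∷
                      c / (r₀ ∷ u ∷ y ∷ a / σ ∷ a / σ ∷ σ) ∷ y ∷ σ)
          where r₀ = rfl (A / σ) (a / σ)

        d⊢′ : ∀ {σ : Sub Exp n m} → ⊢ Δ ctx → Δ ⊢* σ ∶ Γ → Δ ⊢ d / σ ∶ R / (rfl (A / σ) (a / σ) ∷ a / σ ∷ σ)
        d⊢′ {σ = σ} w s = conv-∶ (trans (sym (L./-⊙ R)) (cong (λ τ → R / (rfl (A / σ) (a / σ) ∷ a / σ ∷ τ)) L.id-⊙))
                    (/-term w s d⊢)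

        ind⊢ : ∀ {σ : Sub Exp n m} {y u} → Δ ⊢* σ ∶ Γ → Δ ⊢ y ∶ A / σ → Δ ⊢ u ∶ Id (A / σ) (a / σ) y →
               Δ ⊢ ind σ y u ∶ R / (u ∷ y ∷ σ)
        ind⊢ s y⊢ u⊢ = forth⊢ (y⊢ ∷ s) (conv-∶ (sym I≡) (c⊢ s a′⊢ a′⊢ y⊢ u⊢ (rfl a′⊢))) (conv-∶ (sym I≡) u⊢)
            (conv-∶ (Id-≡ (sym I≡)) (left-unit⊢ s a′⊢ y⊢ u⊢))
            (J⊢ s a′⊢ y⊢ u⊢ (rfl a′⊢) (d⊢′ (term-ctx y⊢) s))
          where a′⊢ = /-term (term-ctx y⊢) s a⊢

        -- By left-unit-rfl, the final transport along left-unit undoes the one along unit in base-case.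
        ind-rfl : ∀ {σ : Sub Exp n m} → ⊢ Δ ctx → Δ ⊢* σ ∶ Γ → let r₀ = rfl (A / σ) (a / σ) in
                  Path Δ (R / (r₀ ∷ a / σ ∷ σ)) (ind σ (a / σ) r₀) (d / σ)
        ind-rfl {σ = σ} w s = transᵖ
            (forth-cong₂ s₁ c⊢′ r⊢ (convᵖ (Id-≡ (sym I≡)) refl refl (left-unit-rfl s a′⊢))
              (J⊢ s a′⊢ a′⊢ r₀⊢ r₀⊢ (d⊢′ w s)))
            (transᵖ (forth-cong₁ s₁ c⊢′ r⊢ p⊢ (J-rfl s a′⊢ r₀⊢ (d⊢′ w s)))
              (forth∘back s₁ c⊢′ r⊢ p⊢ (d⊢′ w s)))
          where
          a′⊢ = /-term w s a⊢
          s₁ : _ ⊢* a / σ ∷ σ ∶ Γ ▹ A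
          s₁ = a′⊢ ∷ s
          r₀⊢ = rfl a′⊢
          r⊢ = conv-∶ (sym I≡) r₀⊢
          c⊢′ = conv-∶ (sym I≡) (c⊢ s a′⊢ a′⊢ a′⊢ r₀⊢ r₀⊢)
          p⊢ = conv-∶ (Id-≡ (sym I≡)) (unit⊢ s a′⊢ a′⊢ r₀⊢)

        -- Makes the restriction of the generic `ind wk² x₁ x₀` along `(a, refl)` an instance of
        -- `ind` to which `ind-rfl` applies.
        ind-/ : ∀ {σ : Sub Exp n m} {y u} (τ : Sub Exp m k) → ind σ y u / τ ≡ ind (σ ⊙ τ) (y / τ) (u / τ)
        ind-/ {σ = σ} {y} {u} τ = trans (sym (L./-⊙ forth)) (cong₃
            (λ j l t → forth / (j ∷ l ∷ u / τ ∷ t ∷ y / τ ∷ σ ⊙ τ))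
            (trans (sym (L./-⊙ J)) (cong₃ (λ e B b → J / (e ∷ rfl B b ∷ u / τ ∷ y / τ ∷ b ∷ σ ⊙ τ)) (sym (L./-⊙ d)) A≡ a≡))
            (trans (sym (L./-⊙ left-unit)) (cong (λ b → left-unit / (u / τ ∷ y / τ ∷ b ∷ σ ⊙ τ)) a≡))
            (trans (sym (L./-⊙ c)) (cong₂ (λ B b → c / (rfl B b ∷ u / τ ∷ y / τ ∷ b ∷ b ∷ σ ⊙ τ)) A≡ a≡)))
          where
          A≡ : A / σ / τ ≡ A / (σ ⊙ τ)
          A≡ = sym (L./-⊙ A)
          a≡ : a / σ / τ ≡ a / (σ ⊙ τ)
          a≡ = sym (L./-⊙ a)

      based-induction : ∃[ j ] Γ ▹Id⟨ A , a ⟩ ⊢ j ∶ R ×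
                        Path Γ (R / (rfl A a ∷ a ∷ id)) (j / (rfl A a ∷ a ∷ id)) d
      based-induction = ind wk² x₁ x₀ , conv-∶ (L.id-vanishes R) (ind⊢ s y⊢ u⊢) ,
          convᵖ (cong₂ (λ B b → R / (rfl B b ∷ b ∷ id)) (L.id-vanishes A) (L.id-vanishes a))
            (trans (cong₂ (λ B b → ind id b (rfl B b)) (L.id-vanishes A) (L.id-vanishes a))
              (sym (trans (ind-/ k₀) (cong (λ σ → ind σ a (rfl A a)) (wk²-⊙-∷ a (rfl A a))))))
            (L.id-vanishes d)
            (ind-rfl wΓ (⊢*-id wΓ))
        where
        k₀ = rfl A a ∷ a ∷ id
        w : ⊢ Γ ▹Id⟨ A , a ⟩ ctx
        w = type-ctx I⊢ ▹ I⊢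
        s² = ⊢*-id w
        s¹ = ⊢*-tail s²
        s : Γ ▹Id⟨ A , a ⟩ ⊢* wk² ∶ Γ
        s = ⊢*-tail s¹
        y⊢ : Γ ▹Id⟨ A , a ⟩ ⊢ x₁ ∶ A / wk²
        y⊢ = ⊢*-head s¹
        u⊢ : Γ ▹Id⟨ A , a ⟩ ⊢ x₀ ∶ Id (A / wk²) (a / wk²) x₁
        u⊢ = conv-∶ I≡ (⊢*-head s²)

    weq-based : WeakEq Γ (rfl A a ∷ a ∷ id) (Γ ▹Id⟨ A , a ⟩)
    weq-based .dom = wΓ
    weq-based .cod = type-ctx I⊢ ▹ I⊢
    weq-based .typed = ⊢*-based (⊢*-id wΓ) (conv-∶ (sym (L.id-vanishes A)) a⊢)
      (conv-∶ (sym (cong₂ (λ B b → Id B b a) (L.id-vanishes A) (L.id-vanishes a))) (rfl a⊢))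
    weq-based .lift R R⊢ d⊢ = based-induction R⊢ d⊢

  -- Extension by a path, and cancellation of weak equivalences.

  /-/-≡ : ∀ (Q : Exp k) {ρ : Sub Exp k m} {σ : Sub Exp m n} {τ} → ρ ⊙ σ ≡ τ → Q / ρ / σ ≡ Q / τ
  /-/-≡ Q refl = sym (L./-⊙ Q)

  -- The map factors as the section `(a, e)` of the projection from `Δ ▹Id⟨ A / f , j / f ⟩` to `Δ`,
  -- followed by the double lifting `f ↑ ↑`. The section is a weak equivalence by `weq-section`,
  -- since the section given by reflexivity is one.
  weq-extend : ∀ {f : Sub Exp n m} {A j a e} → WeakEq Δ f Γ → Γ ⊢ j ∶ A → Δ ⊢ e ∶ Id (A / f) (j / f) a →
               WeakEq Δ (e ∷ a ∷ f) (Γ ▹Id⟨ A , j ⟩)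
  weq-extend {Δ = Δ} {Γ = Γ} {f = f₀} {A} {j} {a} {e} f j⊢ e⊢ =
    subst (λ τ → WeakEq Δ τ (Γ ▹Id⟨ A , j ⟩))
      (trans (↑-⊙-∷ (f₀ ↑)) (cong (e ∷_) (trans (↑-⊙-∷ f₀) (cong (a ∷_) L.⊙-id))))
      (weq-∘ (subst (λ B → WeakEq (Δ ▹ A / f₀ ▹ B) (f₀ ↑ ↑) (Γ ▹Id⟨ A , j ⟩)) I≡ (weq-↑ (weq-↑ f A⊢) I⊢)) u)
    where
    A⊢ = term-type j⊢
    j′⊢ = /-term (dom f) (typed f) j⊢
    ends = Id-endpoints (term-type e⊢)
    I⊢ : Γ ▹ A ⊢ Id (weaken A) (weaken j) x₀ type
    I⊢ = Id (weaken-type A⊢ A⊢) (weaken-term (cod f) A⊢ j⊢) (var₀ A⊢)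
    I≡ : Id (weaken A) (weaken j) x₀ / f₀ ↑ ≡ Id (weaken (A / f₀)) (weaken (j / f₀)) x₀
    I≡ = cong₂ (λ B b → Id B b x₀) (weaken-/-↑ A f₀) (weaken-/-↑ j f₀)
    idΔ = ⊢*-id (dom f)
    u : WeakEq Δ (e ∷ a ∷ id) (Δ ▹Id⟨ A / f₀ , j / f₀ ⟩)
    u = weq-section (BasedPathInduction.weq-based j′⊢) (⊢*-tail (⊢*-tail (⊢*-id (cod (BasedPathInduction.weq-based j′⊢)))))
          (BasedPathInduction.⊢*-based j′⊢ idΔ (conv-∶ (sym (L.id-vanishes _)) (proj₂ (proj₂ ends)))
            (conv-∶ (sym (cong₂ (λ B b → Id B b a) (L.id-vanishes _) (L.id-vanishes _))) e⊢))
          (wk²-⊙-∷ _ _) (wk²-⊙-∷ _ _)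

  -- Liftings along f are unique up to paths, since f also lifts the paths.
  weq-cancelʳ : ∀ {g : Sub Exp l n} {f : Sub Exp n m} → Γ ⊢* g ∶ Θ → WeakEq Δ (g ⊙ f) Θ → WeakEq Δ f Γ → WeakEq Γ g Θ
  weq-cancelʳ g gf f .dom = cod f
  weq-cancelʳ g gf f .cod = cod gf
  weq-cancelʳ g gf f .typed = g
  weq-cancelʳ {g = g₀} {f₀} g gf f .lift Q {d} Q⊢ d⊢ =
    let j , j⊢ , _ , p⊢ = lift gf Q Q⊢ (conv-∶ (sym (L./-⊙ Q)) (/-term (dom f) (typed f) d⊢))
        q , q⊢ , _ = lift f (Id (Q / g₀) (j / g₀) d) (Id (/-type (cod f) g Q⊢) (/-term (cod f) g j⊢) d⊢)
                       (conv-∶ (cong₂ (λ B t → Id B t (d / f₀)) (L./-⊙ Q) (L./-⊙ j)) p⊢)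
    in j , j⊢ , q , q⊢

  -- H plays the role of a homotopy from the identity to s ⊙ g: both are images of H under q and t,
  -- which share the section w.
  weq-cancelˡ : ∀ {f : Sub Exp n m} {g : Sub Exp l n} {s : Sub Exp n l} {w : Sub Exp k n} {q t : Sub Exp n k} {H} →
                Δ ⊢* f ∶ Γ → Γ ⊢* g ∶ Θ → Θ ⊢* s ∶ Γ → WeakEq Γ w Ξ → Ξ ⊢* q ∶ Γ → Ξ ⊢* t ∶ Γ → Γ ⊢* H ∶ Ξ →
                q ⊙ w ≡ id → t ⊙ w ≡ id → q ⊙ H ≡ id → t ⊙ H ≡ s ⊙ g →
                WeakEq Δ (g ⊙ f) Θ → WeakEq Δ f Γ
  weq-cancelˡ f g s w q t H qw tw qH tH gf .dom = dom gf
  weq-cancelˡ f g s w q t H qw tw qH tH gf .cod = dom w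
  weq-cancelˡ f g s w q t H qw tw qH tH gf .typed = f
  weq-cancelˡ {f = f₀} {g₀} {s₀} {w₀} {q₀} {t₀} {H₀} f g s w q t H qw tw qH tH gf .lift Q {d} Q⊢ d⊢ =
    -- The term `d` is moved along `H` from the `q` side to the `t` side, where it lies over `g ∘ f`
    -- and can be lifted; the lift, restricted along `g`, is then moved back.
    let j′ , j′⊢ , p = lift gf (Q / s₀) (/-type (cod gf) s Q⊢) (conv-∶ Qt≡ (term-∷ Qt Hf (fwd⊢ T) d⊢′))
        j⊢ = conv-∶ (trans (/-/-≡ Q qH) (L.id-vanishes Q))
               (term-∷ Qq H (bwd⊢ T) (conv-∶ (trans (sym (L./-⊙ Q)) (sym (/-/-≡ Q tH))) (/-term (dom w) g j′⊢)))
    in _ , j⊢ , convᵖ Qq≡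
                  (trans (cong (λ u → bwd T / (u ∷ H₀ ⊙ f₀)) (L./-⊙ j′)) (L./-⊙ (bwd T))) refl
                  (transᵖ (congᵖ-∷ Qq Hf (bwd⊢ T) (convᵖ (sym Qt≡) refl refl p)) (bwd∘fwd-/ T Hf d⊢′))
    where
    open Transporter
    Qq = Q / q₀
    Qt = Q / t₀
    T : Transporter _ Qq Qt
    T = transporter w (/-type (cod w) q Q⊢) (/-type (cod w) t Q⊢) (trans (/-/-≡ Q qw) (sym (/-/-≡ Q tw)))
    Hf = ⊢*-⊙ (dom gf) H f
    Qq≡ : Qq / (H₀ ⊙ f₀) ≡ Q / f₀
    Qq≡ = /-/-≡ Q (trans L.⊙-assoc (trans (cong (_⊙ f₀) qH) L.id-⊙))
    Qt≡ : Qt / (H₀ ⊙ f₀) ≡ Q / s₀ / (g₀ ⊙ f₀)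
    Qt≡ = trans (/-/-≡ Q (trans L.⊙-assoc (trans (cong (_⊙ f₀) tH) (sym L.⊙-assoc)))) (L./-⊙ Q)
    d⊢′ = conv-∶ (sym Qq≡) d⊢

-- Pullbacks of fibrations and the terminal object.

module PathCategory (Atom : Set) where
  open Syntactic Atom public
  open Category classifying using (_∘_; _≈_) renaming (id to idᶜ)
  open CategoryLemmas classifying
  open Context
  open _⟶_ renaming (typed to typedₘ)

  private variable
    m n : ℕ
    Γ : Ctx n
    A B C D E X Y Z : Context

  equivalences : MapClass classifying 0ℓ
  equivalences = record
    { holds  = λ {Δ} {Γ} f → WeakEq (ctx Δ) (terms f) (ctx Γ)
    ; resp-≈ = λ {Δ} {Γ} → subst (λ τ → WeakEq (ctx Δ) τ (ctx Γ))
    }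

  private
    Fib : A ⟶ B → Set
    Fib = Closure classifying IsDisplay
    W : A ⟶ B → Set
    W f = MapClass.holds equivalences f

  w-iso : ∀ {f : A ⟶ B} → IsIso classifying f → W f
  w-iso {A} {B} {f} i = weq-iso (wf A) (wf B) (typedₘ f) (typedₘ inv) isoʳ isoˡ
    where open IsIso i

  extend : (Γ : Context) {A : Exp (len Γ)} → ctx Γ ⊢ A type → Context
  extend Γ A = ⟨ wf Γ ▹ A ⟩

  proj : (Γ : Context) {A : Exp (len Γ)} (A⊢ : ctx Γ ⊢ A type) → extend Γ A⊢ ⟶ Γ
  proj Γ A⊢ = ⟪ ⊢*-wk (wf Γ) A⊢ ⟫

  module _ (g : Y ⟶ Z) {A : Exp (len Z)} (A⊢ : ctx Z ⊢ A type) where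

    pulled : ctx Y ⊢ A / terms g type
    pulled = /-type (wf Y) (typedₘ g) A⊢

    lifted : extend Y pulled ⟶ extend Z A⊢
    lifted = ⟪ sub-↑ (wf Y) (typedₘ g) pulled ⟫

    display-pullback : IsPullback classifying lifted (proj Y pulled) (proj Z A⊢) g
    display-pullback = record
      { commutes     = trans wk-⊙-∷ (sym (trans (cong (terms g ⊙_) (L.map-weaken)) (trans (cong (terms g ⊙_) L.id-⊙) (sym L.map-weaken))))
      ; universal    = λ {_} {h} {k} → universal h k
      ; p₁∘universal = λ {_} {h} {k} eq → p₁∘universal h k eq
      ; p₂∘universal = λ {_} {h} {k} eq → p₂∘universal h k eq
      ; unique       = λ {_} {u} {v} → unique u v
      }
      where
      universal : ∀ {D} (h : D ⟶ extend Z A⊢) (k : D ⟶ Y) → proj Z A⊢ ∘ h ≈ g ∘ k → D ⟶ extend Y pulled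
      universal ⟪ t ∷ s ⟫ k eq = ⟪ conv-∶ (trans (cong (A /_) (trans (sym wk-⊙-∷) eq)) (L./-⊙ A)) t ∷ typedₘ k ⟫
      p₁∘universal : ∀ {D} (h : D ⟶ extend Z A⊢) (k : D ⟶ Y) (eq : proj Z A⊢ ∘ h ≈ g ∘ k) → lifted ∘ universal h k eq ≈ h
      p₁∘universal ⟪ _∷_ {t = t} _ s ⟫ k eq = trans (↑-⊙-∷ (terms g)) (cong (t ∷_) (trans (sym eq) wk-⊙-∷))
      p₂∘universal : ∀ {D} (h : D ⟶ extend Z A⊢) (k : D ⟶ Y) (eq : proj Z A⊢ ∘ h ≈ g ∘ k) → proj Y pulled ∘ universal h k eq ≈ k
      p₂∘universal ⟪ t ∷ s ⟫ k eq = wk-⊙-∷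
      unique : ∀ {D} (u v : D ⟶ extend Y pulled) → lifted ∘ u ≈ lifted ∘ v → proj Y pulled ∘ u ≈ proj Y pulled ∘ v → u ≈ v
      unique ⟪ _∷_ {t = t} _ s ⟫ ⟪ _∷_ {t = t′} _ s′ ⟫ p q = cong₂ _∷_ (cong head p) (trans (sym wk-⊙-∷) (trans q wk-⊙-∷))

  -- Existence of the pullback, stability of the fibration and stability of weak equivalences under
  -- pullback along `f` are bundled, so that one induction on the closure proves all three for the
  -- same square.
  FibPullback : (f : X ⟶ Z) → Set
  FibPullback {X} {Z} f = ∀ {Y} (g : Y ⟶ Z) →
    Σ[ P ∈ Pullback classifying f g ] Fib (Pullback.p₂ P) × (W g → W (Pullback.p₁ P))

  fibPullback : ∀ {f : X ⟶ Z} → Fib f → FibPullback f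
  fibPullback (base (display w A⊢)) g =
    record { isPullback = display-pullback g A⊢ } , base (display _ (pulled g A⊢)) , λ g∈W → weq-↑ g∈W A⊢
  fibPullback {f = f} (iso i) {Y} g =
    record { P = Y ; p₁ = inv ∘ g ; p₂ = idᶜ ; isPullback = record
      { commutes     = trans L.⊙-assoc (trans (cong (_⊙ terms g) isoʳ) (trans L.id-⊙ (sym L.⊙-id)))
      ; universal    = λ {_} {_} {k} _ → k
      ; p₁∘universal = λ {_} {h} eq → trans (sym L.⊙-assoc) (trans (cong (terms inv ⊙_) (sym eq))
                         (trans L.⊙-assoc (trans (cong (_⊙ terms h) isoˡ) L.id-⊙)))
      ; p₂∘universal = λ _ → L.id-⊙
      ; unique       = λ _ q → trans (sym L.id-⊙) (trans q L.id-⊙) } } ,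
    iso id-iso , λ g∈W → weq-∘ (w-iso {f = inv} record { inv = f ; isoˡ = isoʳ ; isoʳ = isoˡ }) g∈W
    where open IsIso i
  fibPullback (comp f g) h =
    let P , P∈Fib , P∈W = fibPullback f h
        Q , Q∈Fib , Q∈W = fibPullback g (Pullback.p₁ P)
    -- `paste` composes squares along the last leg of the cospan. Flipping puts the composite
    -- fibration in that position.
    in record { isPullback = flip-pullback (paste (flip-pullback (Pullback.isPullback P)) (flip-pullback (Pullback.isPullback Q))) } ,
       comp P∈Fib Q∈Fib , λ h∈W → Q∈W (P∈W h∈W)
  fibPullback (resp p f) g =
    let P , P∈Fib , P∈W = fibPullback f g
    in record { isPullback = pullback-resp-≈ p refl (Pullback.isPullback P) } , P∈Fib , P∈W

  fib-pullback : ∀ {P} {p₁ : P ⟶ X} {p₂ : P ⟶ Y} {f : X ⟶ Z} {g : Y ⟶ Z} →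
                 IsPullback classifying p₁ p₂ f g → Fib f → Fib p₂
  fib-pullback {g = g} isP f∈Fib =
    let Q , q₂∈Fib , _ = fibPullback f∈Fib g
        isQ = Pullback.isPullback Q
    in resp (q₂∘compare isP isQ) (comp q₂∈Fib (iso (compare-iso isP isQ)))

  ⊤ᶜ : Context
  ⊤ᶜ = ⟨ ∅ ⟩

  ⊤-isTerminal : IsTerminal classifying ⊤ᶜ
  ⊤-isTerminal = record { ! = ⟪ [] ⟫ ; !-unique = λ { ⟪ [] ⟫ → refl } }

  fib-to-⊤ : ∀ {A} (f : A ⟶ ⊤ᶜ) → Fib f
  fib-to-⊤ {⟨ ∅ ⟩}       ⟪ [] ⟫ = iso record { inv = ⟪ [] ⟫ ; isoˡ = refl ; isoʳ = refl }
  fib-to-⊤ {⟨ w ▹ A⊢ ⟩} ⟪ [] ⟫ = resp refl (comp (fib-to-⊤ {⟨ w ⟩} ⟪ [] ⟫) (base (display w A⊢)))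

  -- Factorisation of a morphism as a weak equivalence followed by a fibration.

  -- M is the space of pairs (y , z) with a path from g y to z.

  record Factorisation {Y Z : Context} (g : Y ⟶ Z) : Set where
    field
      product : Product classifying Y Z
      {M}     : Context
    open Product product public
    field
      w       : Y ⟶ M
      st      : M ⟶ X×Y
      w∈W     : W w
      st∈Fib  : Fib st
      sw      : π₁ ∘ (st ∘ w) ≈ idᶜ
      tw      : π₂ ∘ (st ∘ w) ≈ g
      -- Extension along a weak equivalence, with its upper triangle commuting up to a path.
      extension : ∀ {D} (u : Y ⟶ D) → W u →
                  Σ[ l ∈ D ⟶ Z ] Σ[ h ∈ Y ⟶ M ] π₁ ∘ (st ∘ h) ≈ idᶜ × π₂ ∘ (st ∘ h) ≈ l ∘ u

  -- The induction step, for one more variable of type `σ`. Lifting `a` along the weak equivalence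
  -- `F.w` gives a term over `F.M` that acts as the transport of `a` along the path already present.
  -- `F.M` is extended by a second component and a path to it from this transport.
  module Extension {n} {Γ : Ctx n} {wΓ : ⊢ Γ ctx} {g : Y ⟶ ⟨ wΓ ⟩} (F : Factorisation g)
                   {σ a} (σ⊢ : Γ ⊢ σ type) (a⊢ : ctx Y ⊢ a ∶ σ / terms g) where
    private
      module F = Factorisation F
      τ⊢ = pulled F.π₂ σ⊢
      T⊢ = pulled F.st τ⊢
      T = σ / terms F.π₂ / terms F.st
      T≡ : ∀ {h : Sub Exp (len F.M) m} {l} → terms F.π₂ ⊙ (terms F.st ⊙ h) ≡ l → T / h ≡ σ / l
      T≡ p = trans (sym (L./-⊙ (σ / terms F.π₂))) (/-/-≡ σ p)
      J = lift F.w∈W T T⊢ (conv-∶ (sym (T≡ F.tw)) a⊢)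
      j⊢ = proj₁ (proj₂ J)
      e  = proj₁ (proj₂ (proj₂ J))
      I⊢ : ctx F.M ▹ T ⊢ Id (weaken T) (weaken (proj₁ J)) x₀ type
      I⊢ = Id (weaken-type T⊢ T⊢) (weaken-term (wf F.M) T⊢ j⊢) (var₀ T⊢)
      w′ : WeakEq (ctx Y) (e ∷ a ∷ terms F.w) (ctx F.M ▹Id⟨ T , proj₁ J ⟩)
      w′ = weq-extend F.w∈W j⊢ (proj₂ (proj₂ (proj₂ J)))
      st↑ = lifted F.st τ⊢
      st≡ : ∀ b p (h : X ⟶ F.M) → terms F.st ↑ ⊙ wk ⊙ (p ∷ b ∷ terms h) ≡ b ∷ terms F.st ⊙ terms h
      st≡ b p h = trans (sym (L.⊙-assoc {ρ₁ = terms F.st ↑} {wk} {p ∷ b ∷ terms h}))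
        (trans (cong (terms F.st ↑ ⊙_) (wk-⊙-∷ {t = p} {b ∷ terms h})) (↑-⊙-∷ (terms F.st)))

      product′ : Product classifying Y ⟨ wΓ ▹ σ⊢ ⟩
      product′ = product-along F.product (display-pullback F.π₂ σ⊢)

      M′ : Context
      M′ = ⟨ wf F.M ▹ T⊢ ▹ I⊢ ⟩

      st′ : M′ ⟶ Product.X×Y product′
      st′ = st↑ ∘ proj _ I⊢

      st′-fib : Fib st′
      st′-fib = comp (fib-pullback {p₂ = st↑} (flip-pullback (display-pullback F.st τ⊢)) F.st∈Fib) (base (display _ I⊢))

      π₁st : ∀ b p (h : X ⟶ F.M) → terms F.π₁ ⊙ wk ⊙ (terms F.st ↑ ⊙ wk ⊙ (p ∷ b ∷ terms h)) ≡ terms (F.π₁ ∘ (F.st ∘ h))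
      π₁st b p h = trans (cong (terms F.π₁ ⊙ wk ⊙_) (st≡ b p h)) (trans (sym (L.⊙-assoc {ρ₁ = terms F.π₁} {wk} {b ∷ terms (F.st ∘ h)}))
        (cong (terms F.π₁ ⊙_) (wk-⊙-∷ {t = b} {terms (F.st ∘ h)})))

      π₂st : ∀ b p (h : X ⟶ F.M) → terms F.π₂ ↑ ⊙ (terms F.st ↑ ⊙ wk ⊙ (p ∷ b ∷ terms h)) ≡ b ∷ terms (F.π₂ ∘ (F.st ∘ h))
      π₂st b p h = trans (cong (terms F.π₂ ↑ ⊙_) (st≡ b p h)) (↑-⊙-∷ (terms F.π₂))

      extension : ∀ {D} (u : Y ⟶ D) → W u →
                  Σ[ l ∈ D ⟶ ⟨ wΓ ▹ σ⊢ ⟩ ] Σ[ h ∈ Y ⟶ M′ ]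
                  Product.π₁ product′ ∘ (st′ ∘ h) ≈ idᶜ × Product.π₂ product′ ∘ (st′ ∘ h) ≈ l ∘ u
      extension u u∈W =
        let l , h , sh , th = F.extension u u∈W
            -- The transport of `a`, restricted along `h`, is lifted along `u`. The lift `b` becomes
            -- the new component of `l`, and its path, reversed, the path component of the new `h`.
            b , b⊢ , p = lift u∈W (σ / terms l) (/-type (cod u∈W) (typedₘ l) σ⊢)
                           (conv-∶ (trans (T≡ th) (L./-⊙ σ)) (/-term (dom u∈W) (typedₘ h) j⊢))
            q , q⊢ = convᵖ (trans (sym (L./-⊙ σ)) (sym (T≡ th))) refl refl (symᵖ p)
            h′⊢ = conv-∶ (cong₂ (λ C c → Id C c (b / terms u)) (sym (L.weaken-∷ T)) (sym (L.weaken-∷ (proj₁ J)))) q⊢ ∷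
                  conv-∶ (trans (sym (L./-⊙ σ)) (sym (T≡ th))) (/-term (dom u∈W) (typedₘ u) b⊢) ∷ typedₘ h
        in ⟪ b⊢ ∷ typedₘ l ⟫ , ⟪ h′⊢ ⟫ , trans (π₁st (b / terms u) q h) sh ,
           trans (π₂st (b / terms u) q h) (cong (b / terms u ∷_) th)

    extended : Factorisation {Z = ⟨ wΓ ▹ σ⊢ ⟩} ⟪ a⊢ ∷ typedₘ g ⟫
    extended = record
      { product = product′
      ; w = ⟪ typed w′ ⟫
      ; st = st′
      ; w∈W = w′
      ; st∈Fib = st′-fib
      ; sw = trans (π₁st a e F.w) F.sw
      ; tw = trans (π₂st a e F.w) (cong (a ∷_) F.tw)
      ; extension = extension
      }

  factorise : ∀ (w : ⊢ Γ ctx) (g : Y ⟶ ⟨ w ⟩) → Factorisation g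
  factorise {Y = Y} ∅ ⟪ [] ⟫ = record
    { product = record
        { X×Y = Y ; π₁ = idᶜ ; π₂ = ⟪ [] ⟫ ; ⟨_,_⟩ = λ h _ → h
        ; π₁∘⟨⟩ = L.id-⊙ ; π₂∘⟨⟩ = λ { {k = ⟪ [] ⟫} → refl }
        ; unique = λ p _ → trans (sym L.id-⊙) (trans p L.id-⊙) }
    ; w = idᶜ
    ; st = idᶜ
    ; w∈W = w-iso {Y} {Y} {idᶜ} id-iso
    ; st∈Fib = iso id-iso
    ; sw = trans L.id-⊙ L.id-⊙
    ; tw = refl
    ; extension = λ u _ → ⟪ [] ⟫ , idᶜ , trans L.id-⊙ L.id-⊙ , refl
    }
  factorise (wΓ ▹ σ⊢) ⟪ a⊢ ∷ g⊢ ⟫ = Extension.extended (factorise wΓ ⟪ g⊢ ⟫) σ⊢ a⊢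

  -- 2-out-of-6, path objects and pullbacks of trivial fibrations.

  -- Extending the identity of `B` along `h ∘ g` gives `l` and a homotopy `H` from the identity to
  -- `l ∘ h ∘ g`. Hence `l ∘ h` is a left homotopy inverse of `g`, and `g` can be cancelled from
  -- `g ∘ f`. Cancellation on the right then yields `g` and `h`.
  w-2-of-6 : ∀ {f : A ⟶ B} {g : B ⟶ C} {h : C ⟶ D} → W (g ∘ f) → W (h ∘ g) → W f × W g × W h × W (h ∘ g ∘ f)
  w-2-of-6 {A} {B} {f = f} {g} {h} gf hg = f∈W , g∈W , h∈W , weq-∘ h∈W gf
    where
    open Factorisation (factorise (wf B) idᶜ)
    r = extension (h ∘ g) hg
    l = proj₁ r
    H = proj₁ (proj₂ r)
    f∈W : W f
    f∈W = weq-cancelˡ {s = terms (l ∘ h)} {w = terms w} {q = terms (π₁ ∘ st)} {t = terms (π₂ ∘ st)} {H = terms H}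
            (typedₘ f) (typedₘ g) (typedₘ (l ∘ h)) w∈W (typedₘ (π₁ ∘ st)) (typedₘ (π₂ ∘ st)) (typedₘ H)
            (trans (sym L.⊙-assoc) sw) (trans (sym L.⊙-assoc) tw)
            (trans (sym L.⊙-assoc) (proj₁ (proj₂ (proj₂ r))))
            (trans (sym L.⊙-assoc) (trans (proj₂ (proj₂ (proj₂ r))) L.⊙-assoc)) gf
    g∈W : W g
    g∈W = weq-cancelʳ (typedₘ g) gf f∈W
    h∈W : W h
    h∈W = weq-cancelʳ (typedₘ h) hg g∈W

  pathObject : ∀ X (X×X : Product classifying X X) → PathObject classifying fibrations equivalences X X×X
  pathObject X X×X = record
    { r          = w
    -- `X×X` is an arbitrary product, so the product that comes with the factorisation is compared
    -- with it.
    ; st         = product-compare product X×X ∘ st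
    ; r∈W        = w∈W
    ; st∈Fib     = comp (iso (product-compare-iso product X×X)) st∈Fib
    ; factorises = P.unique {u = (product-compare product X×X ∘ st) ∘ w} {P.⟨ idᶜ , idᶜ ⟩}
        (trans (proj-st P.π₁ {π₁} (P.π₁∘⟨⟩ {h = π₁} {π₂})) (trans sw (sym (P.π₁∘⟨⟩ {h = idᶜ} {idᶜ}))))
        (trans (proj-st P.π₂ {π₂} (P.π₂∘⟨⟩ {h = π₁} {π₂})) (trans tw (sym (P.π₂∘⟨⟩ {h = idᶜ} {idᶜ}))))
    }
    where
    open Factorisation (factorise (wf X) idᶜ)
    module P = Product X×X
    proj-st : ∀ (π : P.X×Y ⟶ X) {π′ : X×Y ⟶ X} → π ∘ product-compare product X×X ≈ π′ →
              π ∘ ((product-compare product X×X ∘ st) ∘ w) ≈ π′ ∘ (st ∘ w)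
    proj-st π eq = trans (cong (terms π ⊙_) (sym L.⊙-assoc)) (trans L.⊙-assoc (cong (_⊙ terms (st ∘ w)) eq))

  -- Pull f back along t and then along w; then cancel w.
  w-pullback-factored : ∀ {M P} {p₁ : P ⟶ X} {p₂ : P ⟶ Y} {f : X ⟶ Z} {t : M ⟶ Z} {w : Y ⟶ M} (q : M ⟶ Y) →
                        Fib t → W w → q ∘ w ≈ idᶜ → Fib f → W f → IsPullback classifying p₁ p₂ f (t ∘ w) → W p₂
  w-pullback-factored {Y = Y} {p₂ = p₂} {f} {t} {w} q t∈Fib w∈W qw f∈Fib f∈W isP =
    MapClass.resp-≈ equivalences {f = s₂ ∘ φ} {p₂} (q₂∘compare isP isS′) (weq-∘ s₂∈W (w-iso {f = φ} (compare-iso isP isS′)))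
    where
    Q = fibPullback t∈Fib f
    isQ = flip-pullback (Pullback.isPullback (proj₁ Q))
    q₁ = Pullback.p₁ (proj₁ Q)
    S = fibPullback (fib-pullback isQ f∈Fib) w
    isS = Pullback.isPullback (proj₁ S)
    s₁ = Pullback.p₁ (proj₁ S)
    s₂ = Pullback.p₂ (proj₁ S)
    isS′ : IsPullback classifying (Pullback.p₂ (proj₁ Q) ∘ s₁) s₂ f (t ∘ w)
    isS′ = paste isQ isS
    φ = compare isP isS′
    -- The composite equals `q₁ ∘ s₁`, where `q₁` is the pullback of `f` along the fibration `t`,
    -- and `s₁` that of `w` along the fibration `q₁`.
    ws₂∈W : W (w ∘ s₂)
    ws₂∈W = MapClass.resp-≈ equivalences {f = q₁ ∘ s₁} {w ∘ s₂} (IsPullback.commutes isS)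
              (weq-∘ (proj₂ (proj₂ Q) f∈W) (proj₂ (proj₂ S) w∈W))
    s₂∈W : W s₂
    s₂∈W = proj₁ (w-2-of-6 {f = s₂} {w} {q} ws₂∈W
      (MapClass.resp-≈ equivalences {f = idᶜ} {q ∘ w} (sym qw) (w-iso {Y} {Y} {idᶜ} id-iso)))

  trivial-fib-pullback : ∀ {P} {p₁ : P ⟶ X} {p₂ : P ⟶ Y} {f : X ⟶ Z} {g : Y ⟶ Z} →
                         IsPullback classifying p₁ p₂ f g → Fib f → W f → Fib p₂ × W p₂
  trivial-fib-pullback {Z = Z} {p₂ = p₂} {f} {g} isP f∈Fib f∈W =
    fib-pullback isP f∈Fib ,
    w-pullback-factored {p₂ = p₂} {f} {π₂ ∘ st} {w} (π₁ ∘ st)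
      -- The second projection is a pullback of a map to the terminal object, hence a fibration, and
      -- so is its composite with `st`.
      (comp (fib-pullback (product-pullback ⊤-isTerminal product) (fib-to-⊤ _)) st∈Fib)
      w∈W (trans (sym L.⊙-assoc) sw) f∈Fib f∈W
      (pullback-resp-≈ {f = f} {f} {g} {(π₂ ∘ st) ∘ w} refl (sym (trans (sym L.⊙-assoc) tw)) isP)
    where open Factorisation (factorise (wf Z) g)

  -- Sections of trivial fibrations.

  -- Only the lower triangle of the square has to commute, but it commutes strictly, as a section
  -- requires.
  WeaklyLifts : E ⟶ B → Set
  WeaklyLifts {E} {B} p = ∀ {Y D} (u : Y ⟶ D) (d : Y ⟶ E) (g : D ⟶ B) → W u → p ∘ d ≈ g ∘ u →
                          Σ[ j ∈ D ⟶ E ] p ∘ j ≈ g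

  -- The first component is lifted up to a path e. Lifting against p from the space of paths starting at
  -- that component, a weak equivalence by based path induction, moves d along e.
  display-∘-lifts : ∀ {Aₜ} (A⊢ : ctx B ⊢ Aₜ type) {p : E ⟶ extend B A⊢} → WeaklyLifts p → WeaklyLifts (proj B A⊢ ∘ p)
  display-∘-lifts {B = B} {Aₜ = Aₜ} A⊢ {p} p-lifts {Y} {D} u d g u∈W eq =
    proj₁ r , trans (sym L.⊙-assoc) (trans (cong (wk ⊙_) (proj₂ r)) wk-⊙-∷)
    where
    pd = typedₘ (p ∘ d)
    A′ = Aₜ / terms g
    gu = terms g ⊙ terms u
    top : ∀ {τ : Sub Exp _ _} → ctx Y ⊢* τ ∶ (ctx B ▹ Aₜ) → wk ⊙ τ ≡ gu → Σ[ t ∈ Exp _ ] ctx Y ⊢ t ∶ Aₜ / gu × τ ≡ t ∷ gu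
    top (_∷_ {t = t} t⊢ s) eq = let ts≡ = trans (sym wk-⊙-∷) eq in
      t , conv-∶ (cong (Aₜ /_) ts≡) t⊢ , cong (t ∷_) ts≡
    T = top pd (trans L.⊙-assoc eq)
    d₁ = proj₁ T
    d₁⊢ = proj₁ (proj₂ T)
    J = lift u∈W A′ (/-type (cod u∈W) (typedₘ g) A⊢) (conv-∶ (L./-⊙ Aₜ) d₁⊢)
    j⊢ = proj₁ (proj₂ J)
    e = symᵖ (convᵖ (sym (L./-⊙ Aₜ)) refl refl (proj₂ (proj₂ J)))
    k = BasedPathInduction.weq-based d₁⊢
    Y′ : Context
    Y′ = ⟨ cod k ⟩
    k′ : Y ⟶ Y′
    k′ = ⟪ typed k ⟫
    s² = ⊢*-id (cod k)
    s¹ = ⊢*-tail s²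
    ends : Y′ ⟶ extend B A⊢
    ends = ⟪ conv-∶ (sym (L./-⊙ Aₜ)) (⊢*-head s¹) ∷ ⊢*-⊙ (cod k) (typedₘ (g ∘ u)) (⊢*-tail s¹) ⟫
    ends∘ : ∀ b q → terms ends ⊙ (q ∷ b ∷ id) ≡ b ∷ gu
    ends∘ b q = cong (b ∷_) (trans (sym L.⊙-assoc) (trans (cong (gu ⊙_) (wk²-⊙-∷ b q)) L.⊙-id))
    lift₁ = p-lifts k′ d ends k (trans (proj₂ (proj₂ T)) (sym (ends∘ d₁ _)))
    b = proj₁ J / terms u
    v : Y ⟶ Y′
    v = ⟪ BasedPathInduction.⊢*-based d₁⊢ (⊢*-id (wf Y))
            (conv-∶ (trans (sym (L./-⊙ Aₜ)) (sym (L.id-vanishes _))) (/-term (wf Y) (typedₘ u) j⊢))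
            (conv-∶ (sym (cong₂ (λ C c → Id C c b) (L.id-vanishes _) (L.id-vanishes _))) (proj₂ e)) ⟫
    g′ : D ⟶ extend B A⊢
    g′ = ⟪ j⊢ ∷ typedₘ g ⟫
    -- The moved map lies strictly over `g′ ∘ u`, so the hypothesis on `p` applies a second time.
    r = p-lifts u (proj₁ lift₁ ∘ v) g′ u∈W
          (trans L.⊙-assoc (trans (cong (_⊙ terms v) (proj₂ lift₁)) (ends∘ b (proj₁ e))))

  -- The claim is made for `f ∘ p` with arbitrary `p`, so that a composite of fibrations is treated
  -- by adding its factors one at a time. The case of `f` alone is recovered from `p = id`.
  fib-∘-lifts : {f : X ⟶ B} → Fib f → {p : E ⟶ X} → WeaklyLifts p → WeaklyLifts (f ∘ p)
  fib-∘-lifts (base (display w A⊢)) {p} lifts = display-∘-lifts A⊢ {p} lifts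
  fib-∘-lifts {f = f} (iso i) {p} lifts u d g u∈W eq =
    let open IsIso i
        j , pj = lifts u d (inv ∘ g) u∈W
                   (trans (sym L.id-⊙) (trans (cong (_⊙ terms (p ∘ d)) (sym isoˡ)) (trans (sym L.⊙-assoc)
                     (trans (cong (terms inv ⊙_) (trans L.⊙-assoc eq)) L.⊙-assoc))))
    in j , trans (sym L.⊙-assoc) (trans (cong (terms f ⊙_) pj) (trans L.⊙-assoc (trans (cong (_⊙ terms g) isoʳ) L.id-⊙)))
  fib-∘-lifts (comp {f = f} {g} f∈Fib g∈Fib) {p} lifts u d h u∈W eq =
    let j , fgpj = fib-∘-lifts f∈Fib {g ∘ p} (fib-∘-lifts g∈Fib {p} lifts) u d h u∈W (trans (cong (_⊙ terms d) L.⊙-assoc) eq)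
    in j , trans (cong (_⊙ terms j) (sym L.⊙-assoc)) fgpj
  fib-∘-lifts (resp p≈ f) {p} lifts u d g u∈W eq =
    let j , fpj = fib-∘-lifts f {p} lifts u d g u∈W (trans (cong (λ τ → τ ⊙ terms p ⊙ terms d) p≈) eq)
    in j , trans (cong (λ τ → τ ⊙ terms p ⊙ terms j) (sym p≈)) fpj

  trivial-fib-section : ∀ {f : X ⟶ B} → Fib f → W f → Σ[ s ∈ B ⟶ X ] f ∘ s ≈ idᶜ
  trivial-fib-section {X} {f = f} f∈Fib f∈W =
    let s , fs = fib-∘-lifts f∈Fib {idᶜ} id-lifts f idᶜ idᶜ f∈W (trans (cong (_⊙ id) L.⊙-id) (trans L.⊙-id (sym L.id-⊙)))
    in s , trans (cong (_⊙ terms s) (sym L.⊙-id)) fs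
    where
    id-lifts : WeaklyLifts (idᶜ {X})
    id-lifts u d g u∈W eq = g , L.id-⊙

theorem5p4 : (Atom : Set) → let open ObjectiveTypeTheory Atom in
    Σ[ W ∈ MapClass classifying 0ℓ ] IsPathCategory classifying fibrations W
theorem5p4 Atom = equivalences , record
  { fib-∘                = comp
  ; fib-iso              = iso
  ; pullback             = λ f∈Fib g → proj₁ (fibPullback f∈Fib g)
  ; fib-pullback         = fib-pullback
  ; ⊤                    = ⊤ᶜ
  ; ⊤-isTerminal         = ⊤-isTerminal
  ; fib-to-⊤             = fib-to-⊤
  ; w-iso                = λ {_} {_} {f} → w-iso {f = f}
  ; w-2-of-6             = λ {_} {_} {_} {_} {f} {g} {h} → w-2-of-6 {f = f} {g} {h}
  ; pathObject           = pathObject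
  ; trivial-fib-pullback = trivial-fib-pullback
  ; trivial-fib-section  = trivial-fib-section
  }
  where open PathCategory Atom
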